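{- Let $M(B_n)$ denote the number of perfect matchings of the graph $B_n$. For $n\geq31$ we have $$ M(B_n)=3^{4x_n}M(B_{n-30}), $$ where $x_{5k+1}=4k-12$, $x_{5k+2}=4k-10$ and $x_{5k+3}=x_{5k+4}=x_{5k+5}=4k-8$, for $k\geq6$.
   Context: For $n\ge1$, the Aztec diamond graph $AD_n$ has vertices $u_{i,j}$ ($0\le i\le n$, $1\le j\le n$) and $v_{i,j}$ ($1\le i\le n$, $0\le j\le n$), and $4n^2$ edges $\epsilon_{r,s}$, $1\le r,s\le 2n$ (the edge centers form a $2n\times2n$ array), where for $1\le i,j\le n$: $\epsilon_{2i-1,2j-1}=u_{i-1,j}v_{i,j-1}$, $\epsilon_{2i-1,2j}=u_{i-1,j}v_{i,j}$, $\epsilon_{2i,2j-1}=u_{i,j}v_{i,j-1}$, $\epsilon_{2i,2j}=u_{i,j}v_{i,j}$. Let $A$ be the $20\times20$ $0$-$1$ matrix whose rows $1,\dots,20$ are (entries written as strings of digits): 1: 11110101010101011111; 2: 10101111111110101010; 3: 11010101010101111111; 4: 10111111111010101010; 5: 01010101010111111111; 6: 11111111101010101010; 7: 01010101011111111101; 8: 11111110101010101011; 9: 01010101111111110101; 10: 11111010101010101111; 11: 01010111111111010101; 12: 11101010101010111111; 13: 01011111111101010101; 14: 10101010101011111111; 15: 01111111110101010101; 16: 10101010101111111110; 17: 11111111010101010101; 18: 10101010111111111010; 19: 11111101010101010111; 20: 10101011111111101010. (Each row $i+2$ is row $i$ cyclically shifted two places to the left, indices modulo $20$.) $B_n$ is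 the spanning subgraph of $AD_n$ consisting of those edges $\epsilon_{r,s}$ for which the entry of $A$ in row $r'$ and column $s'$ is $1$, where $1\le r',s'\le20$, $r'\equiv r$, $s'\equiv s\pmod{20}$. -}

module Defs where

open import Data.Fin.Base using (Fin; zero; suc; toℕ; inject₁; remQuot)
open import Data.Fin.Patterns using (0F; 1F)
import Data.Fin.Properties as Fin
open import Data.Fin.Subset using (Subset; inside; outside; _∈_; _⊆_)
open import Data.Fin.Subset.Properties using (_∈?_; _⊆?_)
open import Data.List.Base using (List; []; _∷_; _++_; map; filter; length)
open import Data.Nat.Base using (ℕ; zero; suc; _*_; _∸_)
open import Data.Nat.DivMod using (_/_; _mod_)
import Data.Nat.Properties as ℕ
open import Data.Product.Base using (∃; _×_; _,_; proj₁; proj₂)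
open import Data.Sum.Base using (_⊎_)
open import Data.Vec.Base using (Vec; []; _∷_; lookup; tabulate)
open import Level using (0ℓ)
open import Relation.Binary.Definitions using (DecidableEquality)
open import Relation.Binary.PropositionalEquality using (_≡_; refl; cong₂)
open import Relation.Nullary.Decidable
  using (Dec; yes; no; does; map′; _×-dec_; _⊎-dec_; _→-dec_)
open import Relation.Unary using (Pred; Decidable)

-- An index ranging over 0, …, n is an element of Fin (suc n) with that value;
-- an index ranging over 1, …, m is represented by its predecessor in Fin m.
-- So  u i j  is u_{i,j+1}  and  v i j  is v_{i+1,j}.

data Vertex (n : ℕ) : Set where
  u : Fin (suc n) → Fin n → Vertex n
  v : Fin n → Fin (suc n) → Vertex n

-- The edge set of AD_n: the 2n × 2n array, flattened row by row.

Edge : ℕ → Set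
Edge n = Fin (n * 2 * (n * 2))

row col : ∀ n → Edge n → Fin (n * 2)
row n e = proj₁ (remQuot {n * 2} (n * 2) e)
col n e = proj₂ (remQuot {n * 2} (n * 2) e)

-- For i in 1, …, n (represented by its predecessor): the value i - 1 or i
-- in 0, …, n.

shift : ∀ {n} → Fin n → Fin 2 → Fin (suc n)
shift i 0F = inject₁ i
shift i 1F = suc i

-- A position r in 1, …, 2n is 2i - 1 or 2i with 1 ≤ i ≤ n; on predecessors,
-- r - 1 = 2 (i - 1) + b, where b = 0 for 2i - 1 and b = 1 for 2i.  Thus, with
-- s - 1 = 2 (j - 1) + c, the edge ε_{r,s} joins u_{i-1+b,j} and v_{i,j-1+c}.

endpoints : ∀ n → Edge n → Vertex n × Vertex n
endpoints n e =
  let (i , b) = remQuot {n} 2 (row n e)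
      (j , c) = remQuot {n} 2 (col n e)
  in u (shift i b) j , v i (shift j c)

Incident : ∀ n → Vertex n → Edge n → Set
Incident n x e = x ≡ proj₁ (endpoints n e) ⊎ x ≡ proj₂ (endpoints n e)

-- A spanning subgraph has all the vertices of AD_n, so it is given by its
-- edge set.

SpanningSubgraph : ℕ → Set
SpanningSubgraph n = Subset (n * 2 * (n * 2))

ExactlyOne : ∀ {m} → Pred (Fin m) 0ℓ → Set
ExactlyOne P = ∃ λ e → P e × (∀ f → P f → e ≡ f)

IsPerfectMatching : ∀ n → SpanningSubgraph n → Subset (n * 2 * (n * 2)) → Set
IsPerfectMatching n G S =
  S ⊆ G × (∀ (x : Vertex n) → ExactlyOne (λ e → e ∈ S × Incident n x e))

_≟ᵛ_ : ∀ {n} → DecidableEquality (Vertex n)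
u i j ≟ᵛ u k l =
  map′ (λ (p , q) → cong₂ u p q) (λ { refl → refl , refl })
       ((i Fin.≟ k) ×-dec (j Fin.≟ l))
u _ _ ≟ᵛ v _ _ = no λ ()
v _ _ ≟ᵛ u _ _ = no λ ()
v i j ≟ᵛ v k l =
  map′ (λ (p , q) → cong₂ v p q) (λ { refl → refl , refl })
       ((i Fin.≟ k) ×-dec (j Fin.≟ l))

incident? : ∀ n (x : Vertex n) (e : Edge n) → Dec (Incident n x e)
incident? n x e =
  (x ≟ᵛ proj₁ (endpoints n e)) ⊎-dec (x ≟ᵛ proj₂ (endpoints n e))

exactlyOne? : ∀ {m} {P : Pred (Fin m) 0ℓ} → Decidable P → Dec (ExactlyOne P)
exactlyOne? P? =
  Fin.any? λ e → P? e ×-dec Fin.all? λ f → P? f →-dec (e Fin.≟ f)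

allVertices? : ∀ {n} {P : Pred (Vertex n) 0ℓ} → Decidable P → Dec (∀ x → P x)
allVertices? P? =
  map′ (λ { (p , q) (u i j) → p i j ; (p , q) (v i j) → q i j })
       (λ h → (λ i j → h (u i j)) , (λ i j → h (v i j)))
       ((Fin.all? λ i → Fin.all? λ j → P? (u i j))
         ×-dec (Fin.all? λ i → Fin.all? λ j → P? (v i j)))

isPerfectMatching? : ∀ n (G : SpanningSubgraph n) →
                     Decidable (IsPerfectMatching n G)
isPerfectMatching? n G S =
  (S ⊆? G) ×-dec
  allVertices? λ x → exactlyOne? λ e → (e ∈? S) ×-dec incident? n x e

-- Every subset of Fin m, each listed once.

allSubsets : ∀ m → List (Subset m)
allSubsets zero    = [] ∷ []
allSubsets (suc m) =
  map (inside ∷_) (allSubsets m) ++ map (outside ∷_) (allSubsets m)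

M : ∀ n → SpanningSubgraph n → ℕ
M n G = length (filter (isPerfectMatching? n G) (allSubsets _))

A : Vec (Vec ℕ 20) 20
A =
  (1 ∷ 1 ∷ 1 ∷ 1 ∷ 0 ∷ 1 ∷ 0 ∷ 1 ∷ 0 ∷ 1 ∷ 0 ∷ 1 ∷ 0 ∷ 1 ∷ 0 ∷ 1 ∷ 1 ∷ 1 ∷ 1 ∷ 1 ∷ []) ∷
  (1 ∷ 0 ∷ 1 ∷ 0 ∷ 1 ∷ 1 ∷ 1 ∷ 1 ∷ 1 ∷ 1 ∷ 1 ∷ 1 ∷ 1 ∷ 0 ∷ 1 ∷ 0 ∷ 1 ∷ 0 ∷ 1 ∷ 0 ∷ []) ∷
  (1 ∷ 1 ∷ 0 ∷ 1 ∷ 0 ∷ 1 ∷ 0 ∷ 1 ∷ 0 ∷ 1 ∷ 0 ∷ 1 ∷ 0 ∷ 1 ∷ 1 ∷ 1 ∷ 1 ∷ 1 ∷ 1 ∷ 1 ∷ []) ∷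
  (1 ∷ 0 ∷ 1 ∷ 1 ∷ 1 ∷ 1 ∷ 1 ∷ 1 ∷ 1 ∷ 1 ∷ 1 ∷ 0 ∷ 1 ∷ 0 ∷ 1 ∷ 0 ∷ 1 ∷ 0 ∷ 1 ∷ 0 ∷ []) ∷
  (0 ∷ 1 ∷ 0 ∷ 1 ∷ 0 ∷ 1 ∷ 0 ∷ 1 ∷ 0 ∷ 1 ∷ 0 ∷ 1 ∷ 1 ∷ 1 ∷ 1 ∷ 1 ∷ 1 ∷ 1 ∷ 1 ∷ 1 ∷ []) ∷
  (1 ∷ 1 ∷ 1 ∷ 1 ∷ 1 ∷ 1 ∷ 1 ∷ 1 ∷ 1 ∷ 0 ∷ 1 ∷ 0 ∷ 1 ∷ 0 ∷ 1 ∷ 0 ∷ 1 ∷ 0 ∷ 1 ∷ 0 ∷ []) ∷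
  (0 ∷ 1 ∷ 0 ∷ 1 ∷ 0 ∷ 1 ∷ 0 ∷ 1 ∷ 0 ∷ 1 ∷ 1 ∷ 1 ∷ 1 ∷ 1 ∷ 1 ∷ 1 ∷ 1 ∷ 1 ∷ 0 ∷ 1 ∷ []) ∷
  (1 ∷ 1 ∷ 1 ∷ 1 ∷ 1 ∷ 1 ∷ 1 ∷ 0 ∷ 1 ∷ 0 ∷ 1 ∷ 0 ∷ 1 ∷ 0 ∷ 1 ∷ 0 ∷ 1 ∷ 0 ∷ 1 ∷ 1 ∷ []) ∷
  (0 ∷ 1 ∷ 0 ∷ 1 ∷ 0 ∷ 1 ∷ 0 ∷ 1 ∷ 1 ∷ 1 ∷ 1 ∷ 1 ∷ 1 ∷ 1 ∷ 1 ∷ 1 ∷ 0 ∷ 1 ∷ 0 ∷ 1 ∷ []) ∷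
  (1 ∷ 1 ∷ 1 ∷ 1 ∷ 1 ∷ 0 ∷ 1 ∷ 0 ∷ 1 ∷ 0 ∷ 1 ∷ 0 ∷ 1 ∷ 0 ∷ 1 ∷ 0 ∷ 1 ∷ 1 ∷ 1 ∷ 1 ∷ []) ∷
  (0 ∷ 1 ∷ 0 ∷ 1 ∷ 0 ∷ 1 ∷ 1 ∷ 1 ∷ 1 ∷ 1 ∷ 1 ∷ 1 ∷ 1 ∷ 1 ∷ 0 ∷ 1 ∷ 0 ∷ 1 ∷ 0 ∷ 1 ∷ []) ∷
  (1 ∷ 1 ∷ 1 ∷ 0 ∷ 1 ∷ 0 ∷ 1 ∷ 0 ∷ 1 ∷ 0 ∷ 1 ∷ 0 ∷ 1 ∷ 0 ∷ 1 ∷ 1 ∷ 1 ∷ 1 ∷ 1 ∷ 1 ∷ []) ∷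
  (0 ∷ 1 ∷ 0 ∷ 1 ∷ 1 ∷ 1 ∷ 1 ∷ 1 ∷ 1 ∷ 1 ∷ 1 ∷ 1 ∷ 0 ∷ 1 ∷ 0 ∷ 1 ∷ 0 ∷ 1 ∷ 0 ∷ 1 ∷ []) ∷
  (1 ∷ 0 ∷ 1 ∷ 0 ∷ 1 ∷ 0 ∷ 1 ∷ 0 ∷ 1 ∷ 0 ∷ 1 ∷ 0 ∷ 1 ∷ 1 ∷ 1 ∷ 1 ∷ 1 ∷ 1 ∷ 1 ∷ 1 ∷ []) ∷
  (0 ∷ 1 ∷ 1 ∷ 1 ∷ 1 ∷ 1 ∷ 1 ∷ 1 ∷ 1 ∷ 1 ∷ 0 ∷ 1 ∷ 0 ∷ 1 ∷ 0 ∷ 1 ∷ 0 ∷ 1 ∷ 0 ∷ 1 ∷ []) ∷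
  (1 ∷ 0 ∷ 1 ∷ 0 ∷ 1 ∷ 0 ∷ 1 ∷ 0 ∷ 1 ∷ 0 ∷ 1 ∷ 1 ∷ 1 ∷ 1 ∷ 1 ∷ 1 ∷ 1 ∷ 1 ∷ 1 ∷ 0 ∷ []) ∷
  (1 ∷ 1 ∷ 1 ∷ 1 ∷ 1 ∷ 1 ∷ 1 ∷ 1 ∷ 0 ∷ 1 ∷ 0 ∷ 1 ∷ 0 ∷ 1 ∷ 0 ∷ 1 ∷ 0 ∷ 1 ∷ 0 ∷ 1 ∷ []) ∷
  (1 ∷ 0 ∷ 1 ∷ 0 ∷ 1 ∷ 0 ∷ 1 ∷ 0 ∷ 1 ∷ 1 ∷ 1 ∷ 1 ∷ 1 ∷ 1 ∷ 1 ∷ 1 ∷ 1 ∷ 0 ∷ 1 ∷ 0 ∷ []) ∷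
  (1 ∷ 1 ∷ 1 ∷ 1 ∷ 1 ∷ 1 ∷ 0 ∷ 1 ∷ 0 ∷ 1 ∷ 0 ∷ 1 ∷ 0 ∷ 1 ∷ 0 ∷ 1 ∷ 0 ∷ 1 ∷ 1 ∷ 1 ∷ []) ∷
  (1 ∷ 0 ∷ 1 ∷ 0 ∷ 1 ∷ 0 ∷ 1 ∷ 1 ∷ 1 ∷ 1 ∷ 1 ∷ 1 ∷ 1 ∷ 1 ∷ 1 ∷ 0 ∷ 1 ∷ 0 ∷ 1 ∷ 0 ∷ []) ∷
  []

-- Rows and columns of A are also indexed by predecessors, so that r' ≡ r
-- (mod 20) with 1 ≤ r' ≤ 20 becomes r' - 1 = (r - 1) mod 20.

B : ∀ n → SpanningSubgraph n
B n = tabulate λ e →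
  does (lookup (lookup A (toℕ (row n e) mod 20)) (toℕ (col n e) mod 20) ℕ.≟ 1)

-- For n = 5k + r with 1 ≤ r ≤ 5 one has k = (n - 1) / 5 and
-- r - 1 = (n - 1) mod 5.  The truncated subtraction is exact for k ≥ 3,
-- hence whenever n ≥ 31.

x : ℕ → ℕ
x n = 4 * ((n ∸ 1) / 5) ∸ offset ((n ∸ 1) mod 5)
  where
  offset : Fin 5 → ℕ
  offset 0F = 12
  offset 1F = 10
  offset _  = 8

module Submission where

-- The matrix A is such that the cell (i , j), i.e. the 4-cycle of the edges ε with row
-- 2i - 1 or 2i and column 2j - 1 or 2j, has in Bₙ weights x, 1, 1 and w which depend
-- only on i + j modulo 10.  Choose for every vertex shared by two cells the one in
-- which it is matched; then the weighted number of matchings of ADₙ is a sum over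
-- these choices of a product over the cells.  A cell with edge weights
-- x, y, z, w and Δ = xw + yz covers a set of its vertices with Δ times the weight with
-- which a cell with the opposite weights w/Δ, z/Δ, y/Δ, x/Δ covers the complementary
-- set (urban renewal).  The vertices shared by two cells of ADₙ are the vertices of
-- ADₙ₋₁, whose own cells are formed by the edges around the common corners of four
-- cells of ADₙ.  Rescaling at the vertices makes the two middle weights 1 again; then
-- only a factor for each vertex on the lower left boundary is left over.
--
-- Thirty such steps, found by computation, lead back to the weights of B.  The
-- product of the factors is multiplied by 3¹⁶ when n grows by 5, and x grows by 4.

open import Algebra.Bundles using (CommutativeRing; CommutativeSemiring)
open import Algebra.Core using (Op₂)
open import Algebra.Structures using (IsCommutativeSemiring)
open import Data.Bool.Base using (Bool; true; false; not; if_then_else_; T; _∧_; _∨_; _xor_)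
open import Data.Bool.Properties as Bool
  using (not-injective; not-involutive; ∧-identityʳ; ∧-zeroʳ; ∨-identityʳ; T-∧; T?)
open import Data.Empty using (⊥-elim)
open import Data.Fin.Base using (Fin; zero; suc; toℕ; remQuot; _↑ˡ_; _↑ʳ_)
open import Data.Fin.Patterns using (0F; 1F; 2F; 3F; 4F)
import Data.Fin.Properties as Fin
open import Data.Fin.Subset using (Subset; _∈_)
import Data.Integer.Base as ℤ
open import Data.List.Base as List using (List; []; _∷_; length; filter)
import Data.List.Properties as List
open import Data.Nat.Base as ℕ using (ℕ; zero; suc; _+_; _*_; _∸_; _^_; _≡ᵇ_; _≥_)
open import Data.Nat.DivMod
  using (_/_; _mod_; _divMod_; m/n≡1+[m∸n]/n; /-monoˡ-≤; module DivMod)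
import Data.Nat.Properties as ℕ
open import Data.Nat.Tactic.RingSolver using (solve-∀)
open import Data.Product.Base using (∃₂; _×_; _,_; proj₁; proj₂; map₁)
open import Data.Rational.Base using (0ℚ; 1ℚ)
import Data.Rational.Base as ℚ
import Data.Rational.Properties as ℚ
open import Data.Unit.Base using (tt)
open import Data.Vec.Base
  using (Vec; []; _∷_; _++_; lookup; map; replicate; tabulate)
open import Data.Vec.Properties
  using ([]=⇒lookup; lookup⇒[]=; lookup-map; lookup-replicate; lookup∘tabulate; map-replicate;
         tabulate-cong; tabulate∘lookup)
open import Defs
open import Function.Base using (_∘_; case_of_)
open import Function.Bundles using (_⇔_; mk⇔; module Equivalence)
open import Level using (0ℓ)
open import Relation.Binary.PropositionalEquality
  using (_≡_; _≢_; refl; sym; trans; cong; cong₂; subst; module ≡-Reasoning)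
open import Relation.Nullary.Decidable
  using (Dec; yes; no; does; dec-true; does-⇔; map′; toWitness; _×-dec_)
open import Relation.Nullary.Negation using (¬_)
open import Relation.Unary using (Pred; Decidable)

open Equivalence using (to; from)

-- Decidability, and counting in subsets given as Boolean vectors

T-dec : ∀ {Q : Set} (d : Dec Q) → T (does d) → Q
T-dec (yes q) _ = q

dec-T : ∀ {Q : Set} (d : Dec Q) → Q → T (does d)
dec-T (yes _) _ = tt
dec-T (no ¬q) q = ¬q q

bit : Bool → ℕ
bit true  = 1
bit false = 0

-- Degrees and the absence of forbidden edges are both expressed by this function, because it is
-- additive along `_++_` and so can be evaluated row by row.
count : ∀ {m} → Vec Bool m → (Fin m → Bool) → ℕ
count []      φ = 0
count (s ∷ S) φ = bit (s ∧ φ zero) + count S (φ ∘ suc)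

count-cong : ∀ {m} (S : Vec Bool m) {φ ψ : Fin m → Bool} → (∀ e → φ e ≡ ψ e) → count S φ ≡ count S ψ
count-cong []      φ≗ψ = refl
count-cong (s ∷ S) φ≗ψ = cong₂ (λ b n → bit (s ∧ b) + n) (φ≗ψ zero) (count-cong S (φ≗ψ ∘ suc))

count-false : ∀ {m} (S : Vec Bool m) → count S (λ _ → false) ≡ 0
count-false []      = refl
count-false (s ∷ S) = cong₂ (λ b n → bit b + n) (∧-zeroʳ s) (count-false S)

count-++ : ∀ {m n} (S : Vec Bool m) (S′ : Vec Bool n) φ →
           count (S ++ S′) φ ≡ count S (φ ∘ (_↑ˡ n)) + count S′ (φ ∘ (m ↑ʳ_))
count-++ []      S′ φ = refl
count-++ (s ∷ S) S′ φ = trans (cong (bit (s ∧ φ zero) +_) (count-++ S S′ (φ ∘ suc)))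
                              (sym (ℕ.+-assoc (bit (s ∧ φ zero)) _ _))

count≡0⇔ : ∀ {m} (S : Vec Bool m) φ → count S φ ≡ 0 ⇔ (∀ e → lookup S e ≡ true → φ e ≡ false)
count≡0⇔ S φ = mk⇔ (⇒ S φ) (⇐ S φ)
  where
  ⇒ : ∀ {m} (S : Vec Bool m) φ → count S φ ≡ 0 → ∀ e → lookup S e ≡ true → φ e ≡ false
  ⇒ (true ∷ S) φ c zero refl with φ zero
  ... | false = refl
  ⇒ (s ∷ S) φ c (suc e) = ⇒ S (φ ∘ suc) (ℕ.m+n≡0⇒n≡0 (bit (s ∧ φ zero)) c) e
  ⇐ : ∀ {m} (S : Vec Bool m) φ → (∀ e → lookup S e ≡ true → φ e ≡ false) → count S φ ≡ 0
  ⇐ []          φ h = refl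
  ⇐ (true ∷ S)  φ h = cong₂ _+_ (cong bit (h zero refl)) (⇐ S (φ ∘ suc) (h ∘ suc))
  ⇐ (false ∷ S) φ h = ⇐ S (φ ∘ suc) (h ∘ suc)

-- Turns the unique edge at a vertex, as in the definition of a perfect matching, into an equation
-- between numbers, which can be split along rows.
count≡1⇔ : ∀ {m} (S : Vec Bool m) φ →
           count S φ ≡ 1 ⇔ ExactlyOne (λ e → lookup S e ≡ true × φ e ≡ true)
count≡1⇔ S φ = mk⇔ (⇒ S φ) (λ { (e , p , unique) → ⇐ S φ e p unique })
  where
  ∧≡false : ∀ b c → ¬ (b ≡ true × c ≡ true) → b ∧ c ≡ false
  ∧≡false false _     _ = refl
  ∧≡false true  false _ = refl
  ∧≡false true  true  h = ⊥-elim (h (refl , refl))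

  none : ∀ {m} (S : Vec Bool m) φ → count S φ ≡ 0 → ∀ e → ¬ (lookup S e ≡ true × φ e ≡ true)
  none S φ c e (p , q) with () ← trans (sym q) (to (count≡0⇔ S φ) c e p)

  ⇒ : ∀ {m} (S : Vec Bool m) φ → count S φ ≡ 1 → ExactlyOne (λ e → lookup S e ≡ true × φ e ≡ true)
  ⇒ (s ∷ S) φ c with s in s≡ | φ zero in φ≡
  ... | true  | true  = zero , (refl , φ≡) , λ
    { zero    _ → refl
    ; (suc e) h → ⊥-elim (none S (φ ∘ suc) (ℕ.suc-injective c) e h) }
  ... | true  | false with e , p , unique ← ⇒ S (φ ∘ suc) c = suc e , p , λ
    { zero    (_ , q) → case trans (sym φ≡) q of λ ()
    ; (suc f) h       → cong suc (unique f h) }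
  ... | false | _     with e , p , unique ← ⇒ S (φ ∘ suc) c = suc e , p , λ
    { zero    (() , _)
    ; (suc f) h       → cong suc (unique f h) }

  ⇐ : ∀ {m} (S : Vec Bool m) φ e → lookup S e ≡ true × φ e ≡ true →
      (∀ f → lookup S f ≡ true × φ f ≡ true → e ≡ f) → count S φ ≡ 1
  ⇐ (true ∷ S) φ zero (refl , q) unique = cong₂ _+_ (cong bit q)
    (from (count≡0⇔ S (φ ∘ suc)) λ f p → excluded f p)
    where
    excluded : ∀ f → lookup S f ≡ true → φ (suc f) ≡ false
    excluded f p with φ (suc f) in eq
    ... | false = refl
    ... | true with () ← unique (suc f) (p , eq)
  ⇐ (s ∷ S) φ (suc e) h unique = cong₂ _+_ (cong bit excluded)
    (⇐ S (φ ∘ suc) e h (λ f g → Fin.suc-injective (unique (suc f) g)))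
    where
    excluded : s ∧ φ zero ≡ false
    excluded = ∧≡false s (φ zero) λ h → case unique zero h of λ ()

-- Half rows

-- A half row consists of the edges of one row of the array ε, that is of the path
-- v₀ u₀ v₁ u₁ … vₙ.  A set of its edges passes the test if it covers exactly the
-- vertices u selected by a and the vertices v selected by m, each of them once, and
-- uses uⱼvⱼ, resp. uⱼvⱼ₊₁, only if p (k + j), resp. q (k + j), is true; c tells that
-- v₀ is already covered from the left.
half : (p q : ℕ → Bool) → ℕ → Bool → ∀ {n} → Vec Bool (n * 2) → Vec Bool n → Vec Bool (suc n) → Bool
half p q k c []            []      (m ∷ []) = bit c ≡ᵇ bit m
half p q k c (e ∷ f ∷ row) (a ∷ as) (m ∷ ms) =
  (bit e + bit f ≡ᵇ bit a) ∧ (bit c + bit e ≡ᵇ bit m) ∧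
  (not e ∨ p k) ∧ (not f ∨ q k) ∧ half p q (suc k) f row as ms

Position : ℕ → Set
Position n = Fin n × Fin 2

left-u : ∀ {n} → Fin n → Position n → Bool
left-u j (j′ , c) = does (j Fin.≟ j′)

left-v : ∀ {n} → Fin (suc n) → Position n → Bool
left-v j (j′ , c) = does (j Fin.≟ shift j′ c)

pick : Bool → Bool → Fin 2 → Bool
pick p q 0F = p
pick p q 1F = q

forbidden : (p q : ℕ → Bool) → ℕ → ∀ {n} → Position n → Bool
forbidden p q k (j , c) = not (pick (p (k + toℕ j)) (q (k + toℕ j)) c)

shift-suc : ∀ {n} (i : Fin n) b → shift (suc i) b ≡ suc (shift i b)
shift-suc i 0F = refl
shift-suc i 1F = refl

countᵣ : ∀ n → Vec Bool (n * 2) → (Position n → Bool) → ℕ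
countᵣ n row φ = count row (φ ∘ remQuot {n} 2)

-- The test `half` in terms of degrees. The recursive form is suited to evaluating sums, this one to
-- comparison with matchings of the whole graph.
record Half (p q : ℕ → Bool) (k : ℕ) (c : Bool) {n} (row : Vec Bool (n * 2))
            (a : Vec Bool n) (m : Vec Bool (suc n)) : Set where
  constructor mkHalf
  field
    degᵘ    : ∀ j → countᵣ n row (left-u j) ≡ bit (lookup a j)
    degᵛ    : ∀ j → bit (c ∧ does (j Fin.≟ zero)) + countᵣ n row (left-v j) ≡ bit (lookup m j)
    allowed : countᵣ n row (forbidden p q k) ≡ 0

private
  allowed⇒ : ∀ e p → bit (e ∧ not p) ≡ 0 → T (not e ∨ p)
  allowed⇒ false p     _ = tt
  allowed⇒ true  true  _ = tt

  ⇒allowed : ∀ e p → T (not e ∨ p) → bit (e ∧ not p) ≡ 0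
  ⇒allowed false p     _ = refl
  ⇒allowed true  true  _ = refl

module _ (p q : ℕ → Bool) where
  private
    degᵘ-zero : ∀ n e f (row : Vec Bool (n * 2)) →
                countᵣ (suc n) (e ∷ f ∷ row) (left-u zero) ≡ bit e + bit f
    degᵘ-zero n e f row = cong₂ _+_ (cong bit (∧-identityʳ e))
      (trans (cong₂ _+_ (cong bit (∧-identityʳ f)) (count-false row)) (ℕ.+-identityʳ _))

    degᵘ-suc : ∀ n e f (row : Vec Bool (n * 2)) j →
               countᵣ (suc n) (e ∷ f ∷ row) (left-u (suc j)) ≡ countᵣ n row (left-u j)
    degᵘ-suc n e f row j = cong₂ (λ b c → bit b + (bit c + countᵣ n row (left-u j))) (∧-zeroʳ e) (∧-zeroʳ f)

    degᵛ-zero : ∀ n c e f (row : Vec Bool (n * 2)) →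
      bit (c ∧ true) + countᵣ (suc n) (e ∷ f ∷ row) (left-v zero) ≡ bit c + bit e
    degᵛ-zero n c e f row = cong₂ _+_ (cong bit (∧-identityʳ c)) (trans
      (cong₂ (λ b n → bit b + n) (∧-identityʳ e) (cong₂ (λ b n → bit b + n) (∧-zeroʳ f)
        (trans (count-cong row λ s → let (i , b) = remQuot {n} 2 s in
                  cong (λ j → does (zero Fin.≟ j)) (shift-suc i b))
               (count-false row))))
      (ℕ.+-identityʳ _))

    degᵛ-suc : ∀ n c e f (row : Vec Bool (n * 2)) j →
      bit (c ∧ false) + countᵣ (suc n) (e ∷ f ∷ row) (left-v (suc j)) ≡
      bit (f ∧ does (j Fin.≟ zero)) + countᵣ n row (left-v j)
    degᵛ-suc n c e f row j = cong₂ (λ b n → bit b + n) (∧-zeroʳ c)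
      (cong₂ (λ b n → bit b + (bit (f ∧ does (j Fin.≟ zero)) + n)) (∧-zeroʳ e)
        (count-cong row λ s → let (i , b) = remQuot {n} 2 s in
          cong (λ l → does (suc j Fin.≟ l)) (shift-suc i b)))

    forbidden-suc : ∀ {n} k (s : Position n) → forbidden p q k (map₁ suc s) ≡ forbidden p q (suc k) s
    forbidden-suc k (j , c) = cong (λ l → not (pick (p l) (q l) c)) (ℕ.+-suc k (toℕ j))

    forbidden-∷ : ∀ n k e f (row : Vec Bool (n * 2)) →
      countᵣ (suc n) (e ∷ f ∷ row) (forbidden p q k) ≡
      bit (e ∧ not (p k)) + (bit (f ∧ not (q k)) + countᵣ n row (forbidden p q (suc k)))
    forbidden-∷ n k e f row rewrite ℕ.+-identityʳ k = cong
      (λ n → bit (e ∧ not (p k)) + (bit (f ∧ not (q k)) + n))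
      (count-cong row (λ s → forbidden-suc k (remQuot {n} 2 s)))

  -- Induction on the cells: the right edge `f` of the first one becomes the carry `c` for the
  -- others.
  half⇒Half : ∀ k c {n} (row : Vec Bool (n * 2)) (a : Vec Bool n) m →
              T (half p q k c row a m) → Half p q k c row a m
  half⇒Half k c [] [] (m ∷ []) h = mkHalf (λ ())
    (λ { zero → trans (ℕ.+-identityʳ _) (trans (cong bit (∧-identityʳ c)) (ℕ.≡ᵇ⇒≡ _ _ h)) }) refl
  half⇒Half k c {suc n} (e ∷ f ∷ row) (a ∷ as) (m ∷ ms) h
    with h₁ , h ← to T-∧ h with h₂ , h ← to T-∧ h with h₃ , h ← to T-∧ h with h₄ , h ← to T-∧ h
    with mkHalf hᵘ hᵛ hᵃ ← half⇒Half (suc k) f row as ms h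
    = mkHalf
      (λ { zero    → trans (degᵘ-zero n e f row) (ℕ.≡ᵇ⇒≡ _ _ h₁)
         ; (suc j) → trans (degᵘ-suc n e f row j) (hᵘ j) })
      (λ { zero    → trans (degᵛ-zero n c e f row) (ℕ.≡ᵇ⇒≡ _ _ h₂)
         ; (suc j) → trans (degᵛ-suc n c e f row j) (hᵛ j) })
      (trans (forbidden-∷ n k e f row)
        (cong₂ _+_ (⇒allowed e (p k) h₃) (cong₂ _+_ (⇒allowed f (q k) h₄) hᵃ)))

  Half⇒half : ∀ k c {n} (row : Vec Bool (n * 2)) (a : Vec Bool n) m →
              Half p q k c row a m → T (half p q k c row a m)
  Half⇒half k c [] [] (m ∷ []) (mkHalf hᵘ hᵛ hᵃ) = ℕ.≡⇒≡ᵇ _ _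
    (trans (cong bit (sym (∧-identityʳ c))) (trans (sym (ℕ.+-identityʳ _)) (hᵛ zero)))
  Half⇒half k c {suc n} (e ∷ f ∷ row) (a ∷ as) (m ∷ ms) (mkHalf hᵘ hᵛ hᵃ) =
    from T-∧ (ℕ.≡⇒≡ᵇ _ _ (trans (sym (degᵘ-zero n e f row)) (hᵘ zero)) ,
    from T-∧ (ℕ.≡⇒≡ᵇ _ _ (trans (sym (degᵛ-zero n c e f row)) (hᵛ zero)) ,
    from T-∧ (allowed⇒ e (p k) (ℕ.m+n≡0⇒m≡0 _ hᵃ′) ,
    from T-∧ (allowed⇒ f (q k) (ℕ.m+n≡0⇒m≡0 _ hᵃ″) ,
    Half⇒half (suc k) f row as ms (mkHalf
      (λ j → trans (sym (degᵘ-suc n e f row j)) (hᵘ (suc j)))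
      (λ j → trans (sym (degᵛ-suc n c e f row j)) (hᵛ (suc j)))
      (ℕ.m+n≡0⇒n≡0 (bit (f ∧ not (q k))) hᵃ″))))))
    where
    hᵃ′ = trans (sym (forbidden-∷ n k e f row)) hᵃ
    hᵃ″ = ℕ.m+n≡0⇒n≡0 (bit (e ∧ not (p k))) hᵃ′

-- Matchings of r rows of n cells

pos : ∀ r n → Fin (r * 2 * (n * 2)) → Position r × Position n
pos r n e = let (ρ , s) = remQuot {r * 2} (n * 2) e in remQuot {r} 2 ρ , remQuot {n} 2 s

countₛ : ∀ r n → Vec Bool (r * 2 * (n * 2)) → (Position r × Position n → Bool) → ℕ
countₛ r n S φ = count S (φ ∘ pos r n)

next-row : ∀ {r n} → Position r × Position n → Position (suc r) × Position n
next-row = map₁ (map₁ suc)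

module _ {r n} (row₁ row₂ : Vec Bool (n * 2)) (S : Vec Bool (r * 2 * (n * 2))) where

  private
    remQuot-↑ˡ : ∀ {m} k (j : Fin k) → remQuot {suc m} k (j ↑ˡ (m * k)) ≡ (zero , j)
    remQuot-↑ˡ {m} k j = Fin.remQuot-combine {suc m} zero j

    remQuot-↑ʳ : ∀ {m} k (e : Fin (m * k)) → remQuot {suc m} k (k ↑ʳ e) ≡ map₁ suc (remQuot {m} k e)
    remQuot-↑ʳ {m} k e rewrite Fin.splitAt-↑ʳ k (m * k) e = refl

    pos′ : Fin (suc (suc (r * 2))) × Fin (n * 2) → Position (suc r) × Position n
    pos′ (ρ , s) = remQuot {suc r} 2 ρ , remQuot {n} 2 s

  countₛ-++ : ∀ φ → countₛ (suc r) n (row₁ ++ (row₂ ++ S)) φ ≡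
              countᵣ n row₁ (λ s → φ ((zero , 0F) , s)) +
              (countᵣ n row₂ (λ s → φ ((zero , 1F) , s)) + countₛ r n S (φ ∘ next-row))
  countₛ-++ φ = trans (count-++ row₁ (row₂ ++ S) (φ ∘ pos (suc r) n)) (cong₂ _+_
    (count-cong row₁ λ e → cong (φ ∘ pos′) (remQuot-↑ˡ (n * 2) e))
    (trans (count-++ row₂ S _) (cong₂ _+_
      (count-cong row₂ λ e → cong (φ ∘ pos′)
        (trans (remQuot-↑ʳ (n * 2) (e ↑ˡ _)) (cong (map₁ suc) (remQuot-↑ˡ (n * 2) e))))
      (count-cong S λ e → cong (φ ∘ pos′)
        (trans (remQuot-↑ʳ (n * 2) (n * 2 ↑ʳ e)) (cong (map₁ suc) (remQuot-↑ʳ (n * 2) e)))))))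

at-u : ∀ {r n} → Fin (suc r) → Fin n → Position r × Position n → Bool
at-u i j ((i′ , b) , s) = does (i Fin.≟ shift i′ b) ∧ left-u j s

at-v : ∀ {r n} → Fin r → Fin (suc n) → Position r × Position n → Bool
at-v i j ((i′ , b) , s) = does (i Fin.≟ i′) ∧ left-v j s

always : ℕ → Bool
always _ = true

module _ (x w : ℕ → Bool) where

  removed : ℕ → ∀ {r n} → Position r × Position n → Bool
  removed k ((i , 0F) , s) = forbidden x always (k + toℕ i) s
  removed k ((i , 1F) , s) = forbidden always w (k + toℕ i) s

  -- The vertices u of the topmost line are to be covered as selected by a.
  record Matching r n (k : ℕ) (S : Vec Bool (r * 2 * (n * 2))) (a : Vec Bool n) : Set where
    constructor mkMatching
    field
      degᵘ₀   : ∀ j → countₛ r n S (at-u zero j) ≡ bit (lookup a j)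
      degᵘ₊   : ∀ i j → countₛ r n S (at-u (suc i) j) ≡ 1
      degᵛ    : ∀ i j → countₛ r n S (at-v i j) ≡ 1
      allowed : countₛ r n S (removed k) ≡ 0

  matching? : ∀ r n k S a → Dec (Matching r n k S a)
  matching? r n k S a = map′
    (λ (p , q , s , t) → mkMatching p q s t)
    (λ (mkMatching p q s t) → p , q , s , t)
    ((Fin.all? λ j → _ ℕ.≟ _) ×-dec (Fin.all? λ i → Fin.all? λ j → _ ℕ.≟ _) ×-dec
     (Fin.all? λ i → Fin.all? λ j → _ ℕ.≟ _) ×-dec (_ ℕ.≟ _))

  module _ {r n} (row₁ row₂ : Vec Bool (n * 2)) (S : Vec Bool (r * 2 * (n * 2))) where

    private
      S⁺ = row₁ ++ (row₂ ++ S)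

      zero≢shift-suc : ∀ (i : Fin r) b → does (zero Fin.≟ shift (suc i) b) ≡ false
      zero≢shift-suc i b = cong (λ j → does (zero Fin.≟ j)) (shift-suc i b)

      suc≟shift-suc : ∀ i (i′ : Fin r) b →
                      does (suc i Fin.≟ shift (suc i′) b) ≡ does (i Fin.≟ shift i′ b)
      suc≟shift-suc i i′ b = cong (λ j → does (suc i Fin.≟ j)) (shift-suc i′ b)

      at-u-suc : ∀ i (j : Fin n) e → at-u (suc i) j (next-row {r} e) ≡ at-u i j e
      at-u-suc i j ((i′ , b) , s) = cong (_∧ left-u j s) (suc≟shift-suc i i′ b)

      degᵘ-zero : ∀ j → countₛ (suc r) n S⁺ (at-u zero j) ≡ countᵣ n row₁ (left-u j)
      degᵘ-zero j = trans (countₛ-++ {r} {n} row₁ row₂ S (at-u zero j)) (trans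
        (cong (countᵣ n row₁ (left-u j) +_) (cong₂ _+_ (count-false row₂)
          (trans (count-cong S λ e → let ((i′ , b) , s) = pos r n e in
                    cong (_∧ left-u j s) (zero≢shift-suc i′ b)) (count-false S))))
        (ℕ.+-identityʳ _))

      degᵘ-one : ∀ j → countₛ (suc r) n S⁺ (at-u (suc zero) j) ≡
                 countᵣ n row₂ (left-u j) + countₛ r n S (at-u zero j)
      degᵘ-one j = trans (countₛ-++ {r} {n} row₁ row₂ S (at-u (suc zero) j)) (cong₂ _+_ (count-false row₁)
        (cong (countᵣ n row₂ (left-u j) +_) (count-cong S (at-u-suc zero j ∘ pos r n))))

      degᵘ-suc : ∀ i j → countₛ (suc r) n S⁺ (at-u (suc (suc i)) j) ≡ countₛ r n S (at-u (suc i) j)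
      degᵘ-suc i j = trans (countₛ-++ {r} {n} row₁ row₂ S (at-u (suc (suc i)) j))
        (cong₂ _+_ (count-false row₁) (cong₂ _+_ (count-false row₂)
          (count-cong S (at-u-suc (suc i) j ∘ pos r n))))

      degᵛ-zero : ∀ j → countₛ (suc r) n S⁺ (at-v zero j) ≡
                  countᵣ n row₁ (left-v j) + countᵣ n row₂ (left-v j)
      degᵛ-zero j = trans (countₛ-++ {r} {n} row₁ row₂ S (at-v zero j)) (cong (countᵣ n row₁ (left-v j) +_)
        (trans (cong (countᵣ n row₂ (left-v j) +_) (count-false S)) (ℕ.+-identityʳ _)))

      degᵛ-suc : ∀ i j → countₛ (suc r) n S⁺ (at-v (suc i) j) ≡ countₛ r n S (at-v i j)
      degᵛ-suc i j = trans (countₛ-++ {r} {n} row₁ row₂ S (at-v (suc i) j))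
        (cong₂ _+_ (count-false row₁) (cong (_+ countₛ r n S (at-v i j)) (count-false row₂)))

      removed-suc : ∀ k (e : Position r × Position n) → removed k (next-row e) ≡ removed (suc k) e
      removed-suc k ((i , 0F) , s) = cong (λ l → forbidden x always l s) (ℕ.+-suc k (toℕ i))
      removed-suc k ((i , 1F) , s) = cong (λ l → forbidden always w l s) (ℕ.+-suc k (toℕ i))

      removed-∷ : ∀ k → countₛ (suc r) n S⁺ (removed k) ≡
        countᵣ n row₁ (forbidden x always k) +
        (countᵣ n row₂ (forbidden always w k) + countₛ r n S (removed (suc k)))
      removed-∷ k = trans (countₛ-++ {r} {n} row₁ row₂ S (removed k)) (cong₂ _+_
        (cong (λ l → countᵣ n row₁ (forbidden x always l)) (ℕ.+-identityʳ k))
        (cong₂ _+_ (cong (λ l → countᵣ n row₂ (forbidden always w l)) (ℕ.+-identityʳ k))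
          (count-cong S (removed-suc k ∘ pos r n))))

      split-1 : ∀ p q → p + q ≡ 1 → p ≡ bit (p ≡ᵇ 1) × q ≡ bit (not (p ≡ᵇ 1))
      split-1 0 1 refl = refl , refl
      split-1 1 0 refl = refl , refl
      split-1 (suc (suc p)) q ()

      join-1 : ∀ b → bit b + bit (not b) ≡ 1
      join-1 true  = refl
      join-1 false = refl

      bit-injective : ∀ b c → bit b ≡ bit c → b ≡ c
      bit-injective true  true  _ = refl
      bit-injective false false _ = refl

      lookup-injective : ∀ {m} (a b : Vec Bool m) → (∀ j → lookup a j ≡ lookup b j) → a ≡ b
      lookup-injective a b h =
        trans (sym (tabulate∘lookup a)) (trans (tabulate-cong h) (tabulate∘lookup b))

    -- The choices at the shared vertices: `b` selects the vertices u below the first row of cells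
    -- that are matched in this row, `m` the vertices v of the row that are matched in its upper
    -- half. The complements are left to the remaining rows and to the lower half.
    matching-step : ℕ → (a b : Vec Bool n) → Vec Bool (suc n) → Bool
    matching-step k a b m =
      (half x always k false row₁ a m ∧ half always w k false row₂ b (map not m)) ∧
      does (matching? r n (suc k) S (map not b))

    -- A shared vertex has degree 1, which is a sum of two degrees; `b` and `m` record whether the 1
    -- comes from `row₂`, resp. `row₁`.
    Matching⇒step : ∀ k a → Matching (suc r) n k S⁺ a → ∃₂ λ b m → T (matching-step k a b m)
    Matching⇒step k a (mkMatching hᵘ₀ hᵘ₊ hᵛ hᵃ) = b , m ,
      from T-∧ (from T-∧
        ( Half⇒half x always k false row₁ a m (mkHalf
            (λ j → trans (sym (degᵘ-zero j)) (hᵘ₀ j))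
            (λ j → trans (proj₁ (split-v j)) (cong bit (sym (lookup∘tabulate φᵛ j))))
            (ℕ.m+n≡0⇒m≡0 _ hᵃ′))
        , Half⇒half always w k false row₂ b (map not m) (mkHalf
            (λ j → trans (proj₁ (split-u j)) (cong bit (sym (lookup∘tabulate φᵘ j))))
            (λ j → trans (proj₂ (split-v j)) (cong bit (sym (lookup-not j φᵛ))))
            (ℕ.m+n≡0⇒m≡0 _ hᵃ″)))
      , dec-T (matching? r n (suc k) S (map not b)) (mkMatching
          (λ j → trans (proj₂ (split-u j)) (cong bit (sym (lookup-not j φᵘ))))
          (λ i j → trans (sym (degᵘ-suc i j)) (hᵘ₊ (suc i) j))
          (λ i j → trans (sym (degᵛ-suc i j)) (hᵛ (suc i) j))
          (ℕ.m+n≡0⇒n≡0 (countᵣ n row₂ (forbidden always w k)) hᵃ″)))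
      where
      φᵘ : Fin n → Bool
      φᵘ j = countᵣ n row₂ (left-u j) ≡ᵇ 1
      φᵛ : Fin (suc n) → Bool
      φᵛ j = countᵣ n row₁ (left-v j) ≡ᵇ 1
      b = tabulate φᵘ
      m = tabulate φᵛ
      split-u = λ j → split-1 _ (countₛ r n S (at-u zero j)) (trans (sym (degᵘ-one j)) (hᵘ₊ zero j))
      split-v = λ j → split-1 _ (countᵣ n row₂ (left-v j)) (trans (sym (degᵛ-zero j)) (hᵛ zero j))
      hᵃ′ = trans (sym (removed-∷ k)) hᵃ
      hᵃ″ = ℕ.m+n≡0⇒n≡0 (countᵣ n row₁ (forbidden x always k)) hᵃ′
      lookup-not : ∀ {m} (j : Fin m) (φ : Fin m → Bool) → lookup (map not (tabulate φ)) j ≡ not (φ j)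
      lookup-not j φ = trans (lookup-map j not (tabulate φ)) (cong not (lookup∘tabulate φ j))

    step⇒Matching : ∀ k a b m → T (matching-step k a b m) → Matching (suc r) n k S⁺ a
    step⇒Matching k a b m h
      with h , hₛ ← to T-∧ h with h₁ , h₂ ← to T-∧ h
      with mkHalf hᵘ₁ hᵛ₁ hᵃ₁ ← half⇒Half x always k false row₁ a m h₁
      with mkHalf hᵘ₂ hᵛ₂ hᵃ₂ ← half⇒Half always w k false row₂ b (map not m) h₂
      with mkMatching hᵘ₀ hᵘ₊ hᵛ hᵃ ← T-dec (matching? r n (suc k) S (map not b)) hₛ
      = mkMatching
        (λ j → trans (degᵘ-zero j) (hᵘ₁ j))
        (λ { zero    j → trans (degᵘ-one j) (trans
               (cong₂ _+_ (hᵘ₂ j) (trans (hᵘ₀ j) (cong bit (lookup-map j not b)))) (join-1 (lookup b j)))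
           ; (suc i) j → trans (degᵘ-suc i j) (hᵘ₊ i j) })
        (λ { zero    j → trans (degᵛ-zero j) (trans
               (cong₂ _+_ (hᵛ₁ j) (trans (hᵛ₂ j) (cong bit (lookup-map j not m)))) (join-1 (lookup m j)))
           ; (suc i) j → trans (degᵛ-suc i j) (hᵛ i j) })
        (trans (removed-∷ k) (cong₂ _+_ hᵃ₁ (cong₂ _+_ hᵃ₂ hᵃ)))

    -- The degrees determine the choices, so that a matching is counted only once in a sum over all
    -- `b` and `m`.
    step-unique : ∀ k a b m b′ m′ → T (matching-step k a b m) → T (matching-step k a b′ m′) →
                  b ≡ b′ × m ≡ m′
    step-unique k a b m b′ m′ h h′
      with h₁ , h₂ ← to T-∧ (proj₁ (to T-∧ h)) with h₁′ , h₂′ ← to T-∧ (proj₁ (to T-∧ h′)) =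
      lookup-injective b b′ (λ j → bit-injective _ _ (trans
        (sym (degᵘ (half⇒Half always w k false row₂ b (map not m) h₂) j))
        (degᵘ (half⇒Half always w k false row₂ b′ (map not m′) h₂′) j))) ,
      lookup-injective m m′ (λ j → bit-injective _ _ (trans
        (sym (degᵛ (half⇒Half x always k false row₁ a m h₁) j))
        (degᵛ (half⇒Half x always k false row₁ a m′ h₁′) j)))
      where open Half

-- The matrix A

-- Induction in steps of d from the remainder of k; it reduces statements about all k to finite
-- checks.
periodic : ∀ d .{{_ : ℕ.NonZero d}} (P : ℕ → Set) → (∀ (r : Fin d) → P (toℕ r)) →
           (∀ k → P k → P (d + k)) → ∀ k → P k
periodic d P base step k = subst P
  (trans (ℕ.+-comm ((k / d) * d) _) (sym (DivMod.property (k divMod d)))) (go (k / d))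
  where
  go : ∀ q → P (q * d + toℕ (k mod d))
  go zero    = base (k mod d)
  go (suc q) = subst P (sym (ℕ.+-assoc d (q * d) _)) (step _ (go q))

entry : ℕ → ℕ → Bool
entry r s = does (lookup (lookup A (r mod 20)) (s mod 20) ℕ.≟ 1)

-- Read off from the topmost row of cells, where i = 0 and j = k on predecessors.
x₀ w₀ : ℕ → Bool
x₀ k = entry 0 (k * 2)
w₀ k = entry 1 (1 + k * 2)

cell-entry : ℕ → Fin 2 → Fin 2 → Bool
cell-entry k 0F c = pick (x₀ k) true c
cell-entry k 1F c = pick true (w₀ k) c

-- Both sides have period 10 in i and in j, as a cell spans two of the 20 rows and columns of `A`;
-- the remaining hundred cells are compared by computation.
entry≡cell-entry : ∀ i j (b c : Fin 2) → entry (toℕ b + i * 2) (toℕ c + j * 2) ≡ cell-entry (i + j) b c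
entry≡cell-entry = periodic 10 (λ i → ∀ j → Correct i j)
  (λ r → periodic 10 (Correct (toℕ r)) (base r) (step-j (toℕ r)))
  (λ i h j b c → trans (entry-+20ˡ b i (toℕ c + j * 2)) (trans (h j b c) (sym (cell-entry-+10 (i + j) b c))))
  where
  Correct : ℕ → ℕ → Set
  Correct i j = ∀ (b c : Fin 2) → entry (toℕ b + i * 2) (toℕ c + j * 2) ≡ cell-entry (i + j) b c

  base : ∀ (i j : Fin 10) → Correct (toℕ i) (toℕ j)
  base = toWitness {a? = Fin.all? λ i → Fin.all? λ j → Fin.all? λ b → Fin.all? λ c →
    entry (toℕ b + toℕ i * 2) (toℕ c + toℕ j * 2) Bool.≟ cell-entry (toℕ i + toℕ j) b c} tt

  entry-+20ˡ : ∀ (b : Fin 2) i s → entry (toℕ b + (10 + i) * 2) s ≡ entry (toℕ b + i * 2) s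
  -- Once `b` is known, twenty successors are exposed, through which `_mod 20` computes.
  entry-+20ˡ 0F i s = refl
  entry-+20ˡ 1F i s = refl

  entry-+20ʳ : ∀ r (c : Fin 2) j → entry r (toℕ c + (10 + j) * 2) ≡ entry r (toℕ c + j * 2)
  entry-+20ʳ r 0F j = refl
  entry-+20ʳ r 1F j = refl

  cell-entry-+10 : ∀ k b c → cell-entry (10 + k) b c ≡ cell-entry k b c
  cell-entry-+10 k 0F c = refl
  cell-entry-+10 k 1F c = refl

  shift-10 : ∀ i j → i + (10 + j) ≡ 10 + (i + j)
  shift-10 = solve-∀

  step-j : ∀ i j → Correct i j → Correct i (10 + j)
  step-j i j h b c = trans (entry-+20ʳ (toℕ b + i * 2) c j) (trans (h b c) (sym (trans
    (cong (λ k → cell-entry k b c) (shift-10 i j)) (cell-entry-+10 (i + j) b c))))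

B-entry : ∀ n (e : Edge n) → lookup (B n) e ≡ not (removed x₀ w₀ 0 (pos n n e))
B-entry n e = trans (lookup∘tabulate _ e) (trans
  (cong₂ entry (toℕ-remQuot (row n e)) (toℕ-remQuot (col n e)))
  (trans (entry≡cell-entry (toℕ (proj₁ ρ)) (toℕ (proj₁ κ)) (proj₂ ρ) (proj₂ κ)) (unremoved ρ κ)))
  where
  ρ = remQuot {n} 2 (row n e)
  κ = remQuot {n} 2 (col n e)

  toℕ-remQuot : ∀ (r : Fin (n * 2)) →
                toℕ r ≡ toℕ (proj₂ (remQuot {n} 2 r)) + toℕ (proj₁ (remQuot {n} 2 r)) * 2
  toℕ-remQuot r = let (i , b) = remQuot {n} 2 r in
    trans (cong toℕ (sym (Fin.combine-remQuot {n} 2 r)))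
    (trans (Fin.toℕ-combine i b) (trans (ℕ.+-comm (2 * toℕ i) (toℕ b)) (cong (toℕ b +_) (ℕ.*-comm 2 (toℕ i)))))

  unremoved : ∀ (ρ κ : Position n) → cell-entry (toℕ (proj₁ ρ) + toℕ (proj₁ κ)) (proj₂ ρ) (proj₂ κ) ≡
              not (removed x₀ w₀ 0 (ρ , κ))
  unremoved (i , 0F) (j , c) = sym (not-involutive _)
  unremoved (i , 1F) (j , c) = sym (not-involutive _)

-- Numerical data

-- The pair (n , j) stands for n / 6ʲ.
Fraction : Set
Fraction = ℕ × ℕ

infixl 7 _⊛_
infix  4 _≃ᵇ_

_⊛_ : Fraction → Fraction → Fraction
(m , i) ⊛ (n , j) = m * n , i + j

1+ᶠ_ : Fraction → Fraction
1+ᶠ (n , j) = 6 ^ j + n , j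

_≃ᵇ_ : Fraction → Fraction → Bool
(m , i) ≃ᵇ (n , j) = m * 6 ^ j ≡ᵇ n * 6 ^ i

-- The k-th entry is the rescaling factor of the vertices u i j and v i j of Defs with
-- i + j ≡ k (mod 10), together with its inverse.
Step : Set
Step = Vec (Fraction × Fraction) 10

factorᶠ inverseᶠ : Step → ℕ → Fraction
factorᶠ  g k = proj₁ (lookup g (k mod 10))
inverseᶠ g k = proj₂ (lookup g (k mod 10))

Weights : Set
Weights = (ℕ → Fraction) × (ℕ → Fraction)

-- The top left edge of a new cell is the bottom right edge of an old one, and its bottom right edge
-- is the top left edge of the diagonally following old cell, where k is larger by 2. Renewal having
-- exchanged the weights, x again yields x and w yields w.
reduce : Step → Weights → Weights
reduce g (x , w) =
  (λ k → x k ⊛ (factorᶠ g (1 + k) ⊛ inverseᶠ g k)) ,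
  (λ k → w (2 + k) ⊛ (factorᶠ g (2 + k) ⊛ inverseᶠ g (3 + k)))

Valid : Step → Weights → ℕ → Bool
Valid g (x , w) k =
  (factorᶠ g k ⊛ inverseᶠ g k ≃ᵇ (1 , 0)) ∧ (1+ᶠ (x k ⊛ w k) ≃ᵇ factorᶠ g k ⊛ factorᶠ g (1 + k))

every : ℕ → (ℕ → Bool) → Bool
every d P = does (Fin.all? {d} λ r → T? (P (toℕ r)))

AllValid : List Step → Weights → Bool
AllValid []       _  = true
AllValid (g ∷ gs) xw = every 10 (Valid g xw) ∧ AllValid gs (reduce g xw)

Periodic : {S : Set} → (ℕ → S) → Set
Periodic f = ∀ k → f (10 + k) ≡ f k

productᶠ : (ℕ → Fraction) → ℕ → ℕ → Fraction
productᶠ g k zero    = 1 , 0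
productᶠ g k (suc n) = g k ⊛ productᶠ g (suc k) n

-- The diamond of order n has n vertices v on its left and n vertices u on its lower boundary, and a
-- step from order n contributes the factors of these 2n vertices.
totalᶠ : List Step → ℕ → Fraction
totalᶠ []       m = 1 , 0
totalᶠ (g ∷ gs) m = productᶠ (factorᶠ g) 0 (suc (length gs + m) + suc (length gs + m)) ⊛ totalᶠ gs m

-- If the order grows by 5, the product of every step gains ten consecutive factors, that is a full
-- period.
periodᶠ : List Step → Fraction
periodᶠ []       = 1 , 0
periodᶠ (g ∷ gs) = productᶠ (factorᶠ g) 0 10 ⊛ periodᶠ gs

bitᶠ : Bool → Fraction
bitᶠ b = bit b , 0

initial : Weights
initial = bitᶠ ∘ x₀ , bitᶠ ∘ w₀

⟨1⟩ ⟨2⟩ ⟨3⟩ ⟨½⟩ ⟨3/2⟩ ⟨81⟩ ⟨1/81⟩ : Fraction × Fraction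
⟨1⟩    = (1 , 0) , (1 , 0)
⟨2⟩    = (2 , 0) , (3 , 1)
⟨3⟩    = (3 , 0) , (2 , 1)
⟨½⟩    = (3 , 1) , (2 , 0)
⟨3/2⟩  = (9 , 1) , (4 , 1)
⟨81⟩   = (81 , 0) , (16 , 4)
⟨1/81⟩ = (16 , 4) , (81 , 0)

-- With g 2 = 1, the equations g k · g (k + 1) = 1 + x k · w k determine g; as the
-- right-hand side is 1 for k = 2, …, 7, only g 9, g 0 and g 1 differ from 1.
step : (g₉ g₀ g₁ : Fraction × Fraction) → Step
step g₉ g₀ g₁ = g₀ ∷ g₁ ∷ ⟨1⟩ ∷ ⟨1⟩ ∷ ⟨1⟩ ∷ ⟨1⟩ ∷ ⟨1⟩ ∷ ⟨1⟩ ∷ ⟨1⟩ ∷ g₉ ∷ []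

trivial : Step
trivial = step ⟨1⟩ ⟨1⟩ ⟨1⟩

-- The last step has 1 + x k · w k = 1 for all k; there g 2 = 81 is chosen so as to
-- get back the initial weights.
last : Step
last = ⟨81⟩ ∷ ⟨1/81⟩ ∷ ⟨81⟩ ∷ ⟨1/81⟩ ∷ ⟨81⟩ ∷ ⟨1/81⟩ ∷ ⟨81⟩ ∷ ⟨1/81⟩ ∷ ⟨81⟩ ∷ ⟨1/81⟩ ∷ []

-- Opaque, lest the type checker unfold the thirty steps on symbolic arguments.
opaque
  steps : List Step
  steps =
    trivial ∷ step ⟨1⟩ ⟨1⟩ ⟨2⟩   ∷ step ⟨3/2⟩ ⟨2⟩ ⟨3/2⟩ ∷ step ⟨3⟩ ⟨1⟩ ⟨1⟩   ∷ trivial ∷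
    trivial ∷ step ⟨1⟩ ⟨1⟩ ⟨3/2⟩ ∷ step ⟨2⟩ ⟨1⟩ ⟨2⟩     ∷ step ⟨3⟩ ⟨1⟩ ⟨1⟩   ∷ trivial ∷
    trivial ∷ step ⟨1⟩ ⟨1⟩ ⟨3/2⟩ ∷ step ⟨3⟩ ⟨½⟩ ⟨3⟩     ∷ step ⟨2⟩ ⟨1⟩ ⟨1⟩   ∷ trivial ∷
    trivial ∷ step ⟨1⟩ ⟨1⟩ ⟨2⟩   ∷ step ⟨3⟩ ⟨½⟩ ⟨3⟩     ∷ step ⟨3/2⟩ ⟨1⟩ ⟨1⟩ ∷ trivial ∷
    trivial ∷ step ⟨1⟩ ⟨1⟩ ⟨3⟩   ∷ step ⟨2⟩ ⟨1⟩ ⟨2⟩     ∷ step ⟨3/2⟩ ⟨1⟩ ⟨1⟩ ∷ trivial ∷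
    trivial ∷ step ⟨1⟩ ⟨1⟩ ⟨3⟩   ∷ step ⟨3/2⟩ ⟨2⟩ ⟨3/2⟩ ∷ step ⟨2⟩ ⟨1⟩ ⟨1⟩   ∷ last ∷ []

  length-steps : length steps ≡ 30
  length-steps = refl

run : List Step → Weights → Weights
run []       xw = xw
run (g ∷ gs) xw = run gs (reduce g xw)

same-weights : ℕ → Bool
same-weights k = (proj₁ (run steps initial) k ≃ᵇ proj₁ initial k) ∧
                 (proj₂ (run steps initial) k ≃ᵇ proj₂ initial k)

opaque
  unfolding steps

  steps-valid : T (AllValid steps initial)
  steps-valid = tt

  steps-restore-initial : T (every 10 same-weights)
  steps-restore-initial = tt

  steps-period : T (periodᶠ steps ≃ᵇ (3 ^ 16 , 0))
  steps-period = tt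

  steps-total : T (every 5 λ r → totalᶠ steps (suc r) ≃ᵇ (3 ^ (4 * x (31 + r)) , 0))
  steps-total = tt

every⇒ : ∀ d P → T (every d P) → ∀ (r : Fin d) → T (P (toℕ r))
every⇒ d P = T-dec (Fin.all? λ r → T? (P (toℕ r)))

x-+5 : ∀ k → x (36 + k) ≡ 4 + x (31 + k)
x-+5 k = by-residue
  where
  increment : ∀ o → o ℕ.≤ 12 → 4 * ((35 + k) / 5) ∸ o ≡ 4 + (4 * ((30 + k) / 5) ∸ o)
  -- As (30 + k) / 5 is at least 6, the minuend is at least 24 and the truncated subtraction is
  -- exact.
  increment o o≤12 = trans
    (cong (λ q → 4 * q ∸ o) (m/n≡1+[m∸n]/n {35 + k} {5} (ℕ.m≤m+n 5 (30 + k))))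
    (trans (cong (_∸ o) (ℕ.*-suc 4 ((30 + k) / 5))) (ℕ.+-∸-assoc 4 (ℕ.≤-trans o≤12
      (ℕ.≤-trans (ℕ.m≤m+n 12 12) (ℕ.*-monoʳ-≤ 4 (/-monoˡ-≤ 5 (ℕ.m≤m+n 30 k)))))))

  by-residue : x (36 + k) ≡ 4 + x (31 + k)
  -- The residue of 35 + k computes to the same one, so this split fixes both offsets.
  by-residue with (30 + k) mod 5
  ... | 0F = increment 12 ℕ.≤-refl
  ... | 1F = increment 10 (ℕ.m≤m+n 10 2)
  ... | 2F = increment 8 (ℕ.m≤m+n 8 4)
  ... | 3F = increment 8 (ℕ.m≤m+n 8 4)
  ... | 4F = increment 8 (ℕ.m≤m+n 8 4)

-- Sums over Boolean vectors, and weighted half rows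

module WeightedMatchings {R : Set} {add mul : Op₂ R} {0r 1r : R}
  (isCommutativeSemiring : IsCommutativeSemiring _≡_ add mul 0r 1r) where

  commutativeSemiring : CommutativeSemiring 0ℓ 0ℓ
  commutativeSemiring = record { isCommutativeSemiring = isCommutativeSemiring }

  open CommutativeSemiring commutativeSemiring
    using (0#; 1#; +-identityˡ; +-identityʳ; *-identityˡ; *-identityʳ;
           *-assoc; *-comm; zeroˡ; zeroʳ; distribˡ; semiring)
    renaming (_+_ to _⊕_; _*_ to _·_)
  open import Algebra.Properties.Semiring.Exp semiring using (^-homo-*) renaming (_^_ to _^ᴿ_)
  open import Algebra.Properties.Semiring.Mult semiring
    using (×-homo-+; ×1-homo-*) renaming (_×_ to _×ₙ_)
  open import Algebra.Solver.Ring.NaturalCoefficients.Default commutativeSemiring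
    using (solve; _:=_; _:+_; _:*_; con)
  open ≡-Reasoning

  ¬ᵛ : ∀ {n} → Vec Bool n → Vec Bool n
  ¬ᵛ = map not

  ¬ᵛ-involutive : ∀ {n} (a : Vec Bool n) → ¬ᵛ (¬ᵛ a) ≡ a
  ¬ᵛ-involutive []      = refl
  ¬ᵛ-involutive (b ∷ a) = cong₂ _∷_ (not-involutive b) (¬ᵛ-involutive a)

  opaque
    Σ : ∀ n → (Vec Bool n → R) → R
    Σ zero    F = F []
    Σ (suc n) F = Σ n (F ∘ (true ∷_)) ⊕ Σ n (F ∘ (false ∷_))

    Σ-0 : (F : Vec Bool 0 → R) → Σ 0 F ≡ F []
    Σ-0 F = refl

    Σ-suc : ∀ n (F : Vec Bool (suc n) → R) →
            Σ (suc n) F ≡ Σ n (F ∘ (true ∷_)) ⊕ Σ n (F ∘ (false ∷_))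
    Σ-suc n F = refl

    Σ-cong : ∀ n {F G : Vec Bool n → R} → (∀ a → F a ≡ G a) → Σ n F ≡ Σ n G
    Σ-cong zero    F≗G = F≗G []
    Σ-cong (suc n) F≗G = cong₂ _⊕_ (Σ-cong n (F≗G ∘ (true ∷_))) (Σ-cong n (F≗G ∘ (false ∷_)))

    Σ-zero : ∀ n {F : Vec Bool n → R} → (∀ a → F a ≡ 0#) → Σ n F ≡ 0#
    Σ-zero zero    F≗0 = F≗0 []
    Σ-zero (suc n) F≗0 = trans
      (cong₂ _⊕_ (Σ-zero n (F≗0 ∘ (true ∷_))) (Σ-zero n (F≗0 ∘ (false ∷_))))
      (+-identityˡ 0#)

    Σ-· : ∀ n c (F : Vec Bool n → R) → Σ n (λ a → c · F a) ≡ c · Σ n F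
    Σ-· zero    c F = refl
    Σ-· (suc n) c F = trans (cong₂ _⊕_ (Σ-· n c (F ∘ (true ∷_))) (Σ-· n c (F ∘ (false ∷_))))
                            (sym (distribˡ c _ _))

    Σ-+ : ∀ n (F G : Vec Bool n → R) → Σ n (λ a → F a ⊕ G a) ≡ Σ n F ⊕ Σ n G
    Σ-+ zero    F G = refl
    Σ-+ (suc n) F G = trans
      (cong₂ _⊕_ (Σ-+ n (F ∘ (true ∷_)) (G ∘ (true ∷_)))
                 (Σ-+ n (F ∘ (false ∷_)) (G ∘ (false ∷_))))
      (solve 4 (λ p q r s → (p :+ q) :+ (r :+ s) := (p :+ r) :+ (q :+ s)) refl _ _ _ _)

    Σ-swap : ∀ m n (F : Vec Bool m → Vec Bool n → R) →
             Σ m (λ a → Σ n (F a)) ≡ Σ n (λ b → Σ m (λ a → F a b))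
    Σ-swap zero    n F = refl
    Σ-swap (suc m) n F = trans
      (cong₂ _⊕_ (Σ-swap m n (F ∘ (true ∷_))) (Σ-swap m n (F ∘ (false ∷_))))
      (sym (Σ-+ n _ _))

    Σ-¬ : ∀ n (F : Vec Bool n → R) → Σ n (F ∘ ¬ᵛ) ≡ Σ n F
    Σ-¬ zero    F = refl
    Σ-¬ (suc n) F = trans
      (cong₂ _⊕_ (Σ-¬ n (F ∘ (false ∷_))) (Σ-¬ n (F ∘ (true ∷_))))
      (solve 2 (λ p q → p :+ q := q :+ p) refl _ _)

  Σ₁ : (F : Vec Bool 1 → R) → Σ 1 F ≡ F (true ∷ []) ⊕ F (false ∷ [])
  Σ₁ F = trans (Σ-suc 0 F) (cong₂ _⊕_ (Σ-0 _) (Σ-0 _))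

  Σ-·-cong : ∀ n c {F G : Vec Bool n → R} → (∀ a → F a ≡ c · G a) → Σ n F ≡ c · Σ n G
  Σ-·-cong n c F≗cG = trans (Σ-cong n F≗cG) (Σ-· n c _)

  none : ∀ {n} → Vec Bool n → R
  none []          = 1#
  none (true ∷ _)  = 0#
  none (false ∷ a) = none a

  Σ-none : ∀ n (F : Vec Bool n → R) → Σ n (λ a → none a · F a) ≡ F (replicate n false)
  Σ-none zero    F = trans (Σ-0 _) (*-identityˡ _)
  Σ-none (suc n) F = trans (Σ-suc n _)
    (trans (cong₂ _⊕_ (Σ-zero n (λ _ → zeroˡ _)) (Σ-none n _)) (+-identityˡ _))

  δ : Bool → Bool → R
  δ true  true  = 1#
  δ false false = 1#
  δ _     _     = 0#

  -- The weighted number of the edge sets described at half, with p and q as weights.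
  H : (p q : ℕ → R) → ℕ → Bool → ∀ {n} → Vec Bool n → Vec Bool (suc n) → R
  H p q k c     []          (m ∷ [])     = δ c m
  H p q k false (false ∷ a) (false ∷ m)  = H p q (suc k) false a m
  H p q k false (false ∷ a) (true  ∷ m)  = 0#
  H p q k true  (false ∷ a) (false ∷ m)  = 0#
  H p q k true  (false ∷ a) (true  ∷ m)  = H p q (suc k) false a m
  H p q k false (true  ∷ a) (false ∷ m)  = q k · H p q (suc k) true a m
  H p q k false (true  ∷ a) (true  ∷ m)  = p k · H p q (suc k) false a m
  H p q k true  (true  ∷ a) (false ∷ m)  = 0#
  H p q k true  (true  ∷ a) (true  ∷ m)  = q k · H p q (suc k) true a m

  -- Two starting indices are allowed, in order to cover both pointwise equal weights and the index
  -- shift of `H-shift`.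
  H-cong : ∀ {p p′ q q′} k k′ → (∀ j → p (j + k) ≡ p′ (j + k′)) →
           (∀ j → q (j + k) ≡ q′ (j + k′)) →
           ∀ c {n} (a : Vec Bool n) m → H p q k c a m ≡ H p′ q′ k′ c a m
  H-cong {p} {p′} {q} {q′} k k′ p≗p′ q≗q′ = go
    where
    later : ∀ {f f′ : ℕ → R} → (∀ j → f (j + k) ≡ f′ (j + k′)) →
            ∀ j → f (j + suc k) ≡ f′ (j + suc k′)
    later {f} {f′} f≗f′ j = trans (cong f (ℕ.+-suc j k)) (trans (f≗f′ (suc j)) (cong f′ (sym (ℕ.+-suc j k′))))

    rest : ∀ c {n} (a : Vec Bool n) m → H p q (suc k) c a m ≡ H p′ q′ (suc k′) c a m
    rest = H-cong (suc k) (suc k′) (later {p} {p′} p≗p′) (later {q} {q′} q≗q′)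

    go : ∀ c {n} (a : Vec Bool n) m → H p q k c a m ≡ H p′ q′ k′ c a m
    go c     []          (m ∷ [])    = refl
    go false (false ∷ a) (false ∷ m) = rest false a m
    go false (false ∷ a) (true  ∷ m) = refl
    go true  (false ∷ a) (false ∷ m) = refl
    go true  (false ∷ a) (true  ∷ m) = rest false a m
    go false (true  ∷ a) (false ∷ m) = cong₂ _·_ (q≗q′ 0) (rest true a m)
    go false (true  ∷ a) (true  ∷ m) = cong₂ _·_ (p≗p′ 0) (rest false a m)
    go true  (true  ∷ a) (false ∷ m) = refl
    go true  (true  ∷ a) (true  ∷ m) = cong₂ _·_ (q≗q′ 0) (rest true a m)

  H-shift : ∀ p q k c {n} (a : Vec Bool n) m →
            H p q (suc k) c a m ≡ H (p ∘ suc) (q ∘ suc) k c a m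
  H-shift p q k = H-cong (suc k) k (λ j → cong p (ℕ.+-suc j k)) (λ j → cong q (ℕ.+-suc j k))

  -- Every edge covers a vertex v, so only the empty edge set is left.
  H-none : ∀ p q k {n} (a : Vec Bool n) → H p q k false a (replicate (suc n) false) ≡ none a
  H-none p q k []          = refl
  H-none p q k (false ∷ a) = H-none p q (suc k) a
  H-none p q k (true ∷ a)  = trans (cong (q k ·_) (H-true a)) (zeroʳ _)
    where
    H-true : ∀ {n} (a : Vec Bool n) → H p q (suc k) true a (replicate (suc n) false) ≡ 0#
    H-true []          = refl
    H-true (false ∷ a) = refl
    H-true (true ∷ a)  = refl

  -- Rows of cells as products over their cells

  one : ℕ → R
  one _ = 1#

  -- A cell has a top and a bottom vertex u, a left and a right vertex v, and edges of
  -- weight x (top left), 1, 1 and w (bottom right).  It has to cover the top, bottom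
  -- and left vertex according to a, b and s, which determines whether it covers the
  -- right one; next tells whether the following cell then has to cover that vertex.
  -- In a row of cells C, the rightmost vertex v is to be covered iff e is false.

  κ : (x w : R) (a b s : Bool) → R
  κ x w false false true  = 0#
  κ x w true  false true  = x
  κ x w false true  true  = 1#
  κ x w true  true  true  = 1# ⊕ x · w
  κ x w false false false = 1#
  κ x w true  false false = 1#
  κ x w false true  false = w
  κ x w true  true  false = 0#

  next : (a b s : Bool) → Bool
  -- A cell covers as many vertices u as v, so it covers the right one iff a + b + s is odd.
  next a b s = not (a xor (b xor s))

  C : (x w : ℕ → R) → Bool → ℕ → ∀ {n} → Vec Bool n → Vec Bool n → Bool → R
  C x w e k []      []      s = δ e s
  C x w e k (a ∷ as) (b ∷ bs) s = κ (x k) (w k) a b s · C x w e (suc k) as bs (next a b s)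

  private
    ·ˡ : ∀ c p q → (c · p) · q ≡ c · (p · q)
    ·ˡ = *-assoc

    ·ʳ : ∀ c p q → p · (c · q) ≡ c · (p · q)
    ·ʳ = solve 3 (λ c p q → p :* (c :* q) := c :* (p :* q)) refl

    ·ˡʳ : ∀ c d p q → (c · p) · (d · q) ≡ (c · d) · (p · q)
    ·ˡʳ = solve 4 (λ c d p q → (c :* p) :* (d :* q) := (c :* d) :* (p :* q)) refl

    1· : ∀ p q → p · q ≡ 1# · (p · q)
    1· p q = sym (*-identityˡ _)

  module _ {n} {F : Vec Bool (suc n) → R} where

    -- For inductions on the first cell: the choice at its vertex is forced, or else both choices
    -- survive, and the coefficients are weights of that cell.
    Σ-left : ∀ {c r G} → (∀ a → F (true ∷ a) ≡ c · G a) → (∀ a → F (false ∷ a) ≡ 0#) →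
             Σ n G ≡ r → Σ (suc n) F ≡ c · r
    Σ-left {c} F≗cG F≗0 refl = trans (Σ-suc n F)
      (trans (cong₂ _⊕_ (Σ-·-cong n c F≗cG) (Σ-zero n F≗0)) (+-identityʳ _))

    Σ-right : ∀ {c r G} → (∀ a → F (true ∷ a) ≡ 0#) → (∀ a → F (false ∷ a) ≡ c · G a) →
              Σ n G ≡ r → Σ (suc n) F ≡ c · r
    Σ-right {c} F≗0 F≗cG refl = trans (Σ-suc n F)
      (trans (cong₂ _⊕_ (Σ-zero n F≗0) (Σ-·-cong n c F≗cG)) (+-identityˡ _))

    Σ-both : ∀ {c d r s G G′} → (∀ a → F (true ∷ a) ≡ c · G a) → (∀ a → F (false ∷ a) ≡ d · G′ a) →
             Σ n G ≡ r → Σ n G′ ≡ s → Σ (suc n) F ≡ c · r ⊕ d · s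
    Σ-both {c} {d} F≗cG F≗dG′ refl refl =
      trans (Σ-suc n F) (cong₂ _⊕_ (Σ-·-cong n c F≗cG) (Σ-·-cong n d F≗dG′))

  Row : (x w : ℕ → R) → ℕ → ∀ {n} → Vec Bool n → Vec Bool n → R
  Row x w k {n} a b = Σ (suc n) λ m → H x one k false a m · H one w k false b (¬ᵛ m)

  module _ (x w : ℕ → R) where

    -- The carries `c` and `d` tell that the first vertex v is already covered from the left in the
    -- upper, resp. lower, half row.
    P : ℕ → Bool → Bool → ∀ {n} → Vec Bool n → Vec Bool n → R
    P k c d {n} a b = Σ (suc n) λ m → H x one k c a m · H one w k d b (¬ᵛ m)

    P₁₁≡0 : ∀ k {n} (a b : Vec Bool n) → P k true true a b ≡ 0#
    P₁₁≡0 k {n} a b = Σ-zero (suc n) (vanish a b)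
      where
      vanish : ∀ {n} (a b : Vec Bool n) m → H x one k true a m · H one w k true b (¬ᵛ m) ≡ 0#
      vanish []          []          (true ∷ [])  = zeroʳ _
      vanish []          []          (false ∷ []) = zeroˡ _
      vanish (_ ∷ _)     (true ∷ _)  (true ∷ _)   = zeroʳ _
      vanish (_ ∷ _)     (false ∷ _) (true ∷ _)   = zeroʳ _
      vanish (true ∷ _)  (_ ∷ _)     (false ∷ _)  = zeroˡ _
      vanish (false ∷ _) (_ ∷ _)     (false ∷ _)  = zeroˡ _

    -- Mutual induction on the first cell. Which half row has covered the first vertex from the left
    -- is irrelevant, so both such states correspond to the value `false` of `s`.
    P₀₀≡C : ∀ k {n} (a b : Vec Bool n) → P k false false a b ≡ C x w false k a b true
    P₁₀≡C : ∀ k {n} (a b : Vec Bool n) → P k true false a b ≡ C x w false k a b false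
    P₀₁≡C : ∀ k {n} (a b : Vec Bool n) → P k false true a b ≡ C x w false k a b false

    P₀₀≡C k [] [] = trans (Σ₁ _) (trans (cong₂ _⊕_ (zeroˡ _) (zeroʳ _)) (+-identityˡ 0#))
    P₀₀≡C k (false ∷ a) (false ∷ b) = trans
      (Σ-zero _ λ { (true ∷ _) → zeroˡ _ ; (false ∷ _) → zeroʳ _ }) (sym (zeroˡ _))
    P₀₀≡C k (true  ∷ a) (false ∷ b) =
      Σ-left (λ m → ·ˡ (x k) _ _) (λ m → zeroʳ _) (P₀₀≡C (suc k) a b)
    P₀₀≡C k (false ∷ a) (true  ∷ b) =
      Σ-right (λ m → zeroˡ _) (λ m → ·ʳ 1# _ _) (P₀₀≡C (suc k) a b)
    -- Here two pairs of opposite edges compete, of weights xw and 1.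
    P₀₀≡C k (true  ∷ a) (true  ∷ b) = trans
      (Σ-both (λ m → ·ˡʳ (x k) (w k) _ _) (λ m → ·ˡʳ 1# 1# _ _) (P₀₁≡C (suc k) a b) (P₁₀≡C (suc k) a b))
      (solve 3 (λ x w c → (x :* w) :* c :+ (con 1 :* con 1) :* c := (con 1 :+ x :* w) :* c) refl _ _ _)

    P₁₀≡C k [] [] = trans (Σ₁ _) (trans (cong₂ _⊕_ (*-identityˡ _) (zeroˡ _)) (+-identityʳ _))
    P₁₀≡C k (false ∷ a) (false ∷ b) =
      Σ-left (λ m → 1· _ _) (λ m → zeroˡ _) (P₀₀≡C (suc k) a b)
    P₁₀≡C k (true  ∷ a) (false ∷ b) =
      Σ-left (λ m → ·ˡ 1# _ _) (λ m → zeroˡ _) (P₁₀≡C (suc k) a b)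
    P₁₀≡C k (false ∷ a) (true  ∷ b) =
      Σ-left (λ m → ·ʳ (w k) _ _) (λ m → zeroˡ _) (P₀₁≡C (suc k) a b)
    P₁₀≡C k (true  ∷ a) (true  ∷ b) = trans
      (Σ-left (λ m → ·ˡʳ 1# (w k) _ _) (λ m → zeroˡ _) (P₁₁≡0 (suc k) a b))
      (trans (zeroʳ _) (sym (zeroˡ _)))

    P₀₁≡C k [] [] = trans (Σ₁ _) (trans (cong₂ _⊕_ (zeroˡ _) (*-identityˡ _)) (+-identityˡ _))
    P₀₁≡C k (false ∷ a) (false ∷ b) =
      Σ-right (λ m → zeroʳ _) (λ m → 1· _ _) (P₀₀≡C (suc k) a b)
    P₀₁≡C k (true  ∷ a) (false ∷ b) =
      Σ-right (λ m → zeroʳ _) (λ m → ·ˡ 1# _ _) (P₁₀≡C (suc k) a b)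
    P₀₁≡C k (false ∷ a) (true  ∷ b) =
      Σ-right (λ m → zeroʳ _) (λ m → ·ʳ (w k) _ _) (P₀₁≡C (suc k) a b)
    P₀₁≡C k (true  ∷ a) (true  ∷ b) = trans
      (Σ-right (λ m → zeroʳ _) (λ m → ·ˡʳ 1# (w k) _ _) (P₁₁≡0 (suc k) a b))
      (trans (zeroʳ _) (sym (zeroˡ _)))

  Row≡C : ∀ x w k {n} (a b : Vec Bool n) → Row x w k a b ≡ C x w false k a b true
  Row≡C x w = P₀₀≡C x w

  module _ (x w : ℕ → R) where

    -- A row of cells without its outermost vertices v, read with u and v interchanged. From a
    -- shared v the upper path goes on along the top left edge of the next cell, hence `x ∘ suc`.
    Q : ℕ → Bool → Bool → ∀ {n} → Vec Bool (suc n) → Vec Bool (suc n) → R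
    Q k c d {n} a b = Σ n λ m → H one (x ∘ suc) k c m a · H w one k d (¬ᵛ m) b

    private
      0≡0+0 : ∀ {c p q} → p ≡ 0# → q ≡ 0# → 0# · c ≡ p ⊕ q
      0≡0+0 refl refl = trans (zeroˡ _) (sym (+-identityˡ 0#))

      0≡c·0+0 : ∀ {c d p q} → p ≡ 0# → q ≡ 0# → 0# · d ≡ c · p ⊕ q
      0≡c·0+0 refl refl = 0≡0+0 (zeroʳ _) refl

    C≡Q₀ : ∀ k {n} (a b : Vec Bool (suc n)) → C x w true k a b false ≡ Q k false false a b
    -- The left vertex is matched with the top one, by the edge of weight x, or with the bottom one,
    -- by an edge of weight 1.
    C≡Q₁ : ∀ k {n} (a b : Vec Bool (suc n)) →
           C x w true k a b true ≡ x k · Q k true false a b ⊕ Q k false true a b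

    C≡Q₀ k (false ∷ []) (false ∷ []) = sym (Σ-0 _)
    C≡Q₀ k (true  ∷ []) (false ∷ []) = trans (zeroʳ _) (sym (trans (Σ-0 _) (zeroˡ _)))
    C≡Q₀ k (false ∷ []) (true  ∷ []) = trans (zeroʳ _) (sym (trans (Σ-0 _) (zeroʳ _)))
    C≡Q₀ k (true  ∷ []) (true  ∷ []) = trans (zeroˡ _) (sym (trans (Σ-0 _) (zeroˡ _)))
    C≡Q₀ k (false ∷ a@(_ ∷ _)) (false ∷ b@(_ ∷ _)) = trans
      (cong (1# ·_) (C≡Q₁ (suc k) a b))
      (trans (solve 3 (λ x p q → con 1 :* (x :* p :+ q) := x :* p :+ con 1 :* q) refl _ _ _)
        (sym (Σ-both (λ m → ·ˡ (x (suc k)) _ _) (λ m → ·ʳ 1# _ _) refl refl)))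
    C≡Q₀ k (true  ∷ a@(_ ∷ _)) (false ∷ b@(_ ∷ _)) = trans
      (cong (1# ·_) (C≡Q₀ (suc k) a b))
      (sym (Σ-left (λ m → ·ˡ 1# _ _) (λ m → zeroˡ _) refl))
    C≡Q₀ k (false ∷ a@(_ ∷ _)) (true  ∷ b@(_ ∷ _)) = trans
      (cong (w k ·_) (C≡Q₀ (suc k) a b))
      (sym (Σ-right (λ m → zeroʳ _) (λ m → ·ʳ (w k) _ _) refl))
    C≡Q₀ k (true  ∷ a@(_ ∷ _)) (true  ∷ b@(_ ∷ _)) = trans (zeroˡ _)
      (sym (Σ-zero _ λ { (true ∷ _) → zeroʳ _ ; (false ∷ _) → zeroˡ _ }))

    C≡Q₁ k (false ∷ []) (false ∷ []) =
      0≡c·0+0 (trans (Σ-0 _) (zeroˡ _)) (trans (Σ-0 _) (zeroʳ _))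
    C≡Q₁ k (true  ∷ []) (false ∷ []) = sym
      (trans (cong₂ (λ p q → x k · p ⊕ q) (trans (Σ-0 _) (*-identityˡ _)) (trans (Σ-0 _) (zeroˡ _)))
             (+-identityʳ _))
    C≡Q₁ k (false ∷ []) (true  ∷ []) = sym
      (trans (cong₂ (λ p q → x k · p ⊕ q) (trans (Σ-0 _) (zeroˡ _)) (trans (Σ-0 _) (*-identityˡ _)))
             (solve 1 (λ x → x :* con 0 :+ con 1 := con 1 :* con 1) refl (x k)))
    C≡Q₁ k (true  ∷ []) (true  ∷ []) = trans
      (trans (zeroʳ _) (sym (zeroˡ 0#)))
      (0≡c·0+0 (trans (Σ-0 _) (zeroʳ _)) (trans (Σ-0 _) (zeroˡ _)))
    C≡Q₁ k (false ∷ a@(_ ∷ _)) (false ∷ b@(_ ∷ _)) = 0≡c·0+0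
      (Σ-zero _ λ { (true ∷ _) → zeroˡ _ ; (false ∷ _) → zeroˡ _ })
      (Σ-zero _ λ { (true ∷ _) → zeroʳ _ ; (false ∷ _) → zeroʳ _ })
    C≡Q₁ k (true  ∷ a@(_ ∷ _)) (false ∷ b@(_ ∷ _)) = trans
      (cong (x k ·_) (C≡Q₁ (suc k) a b))
      (trans (solve 4 (λ y x p q → y :* (x :* p :+ q) := y :* (x :* p :+ con 1 :* q) :+ con 0) refl _ _ _ _)
        (sym (cong₂ (λ p q → x k · p ⊕ q)
          (Σ-both (λ m → ·ˡ (x (suc k)) _ _) (λ m → ·ʳ 1# _ _) refl refl)
          (Σ-zero _ λ { (true ∷ _) → zeroʳ _ ; (false ∷ _) → zeroˡ _ }))))
    C≡Q₁ k (false ∷ a@(_ ∷ _)) (true  ∷ b@(_ ∷ _)) = trans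
      (cong (1# ·_) (C≡Q₁ (suc k) a b))
      (trans (solve 4 (λ y x p q → con 1 :* (x :* p :+ q) := y :* con 0 :+ (x :* p :+ con 1 :* q)) refl (x k) _ _ _)
        (sym (cong₂ (λ p q → x k · p ⊕ q)
          (Σ-zero _ λ { (true ∷ _) → zeroˡ _ ; (false ∷ _) → zeroˡ _ })
          (Σ-both (λ m → ·ˡ (x (suc k)) _ _) (λ m → ·ʳ 1# _ _) refl refl))))
    C≡Q₁ k (true  ∷ a@(_ ∷ _)) (true  ∷ b@(_ ∷ _)) = trans
      (cong ((1# ⊕ x k · w k) ·_) (C≡Q₀ (suc k) a b))
      (trans (solve 3 (λ x w p → (con 1 :+ x :* w) :* p := x :* (w :* p) :+ con 1 :* p) refl _ _ _)
        (sym (cong₂ (λ p q → x k · p ⊕ q)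
          (Σ-right (λ m → zeroʳ _) (λ m → ·ʳ (w k) _ _) refl)
          (Σ-left (λ m → ·ˡ 1# _ _) (λ m → zeroˡ _) refl))))

  -- The weighted number of matchings of r rows of cells, the first of which begins
  -- with a cell of weights x k and w k, where the vertices u of the topmost line are
  -- to be covered as selected by a.  Z′ is the same for the complementary boundary
  -- condition: the vertices v at both ends of the rows and the lowest vertices u are
  -- not covered.

  Z : (x w : ℕ → R) → ∀ {n} → ℕ → ℕ → Vec Bool n → R
  Z x w     zero    k a = none a
  Z x w {n} (suc r) k a = Σ n λ b → Row x w k a b · Z x w r (suc k) (¬ᵛ b)

  Z′ : (x w : ℕ → R) → ∀ {n} → ℕ → ℕ → Vec Bool n → R
  Z′ x w     zero    k a = none (¬ᵛ a)
  Z′ x w {n} (suc r) k a = Σ n λ b → C x w true k a b false · Z′ x w r (suc k) (¬ᵛ b)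

  -- Urban renewal

  product : (ℕ → R) → ℕ → ℕ → R
  product g k zero    = 1#
  product g k (suc n) = g k · product g (suc k) n

  module _ (x w g ĝ : ℕ → R) (g·ĝ≡1 : ∀ k → g k · ĝ k ≡ 1#)
           (1+xw≡gg : ∀ k → 1# ⊕ x k · w k ≡ g k · g (suc k)) where

    -- With Δ = g k · g (k + 1), rescaling multiplies w/Δ twice by g k, x/Δ twice by g (k + 1), and
    -- both middle weights 1/Δ once by each, which makes these 1.
    x̂ ŵ : ℕ → R
    x̂ k = x k · (g (suc k) · ĝ k)
    ŵ k = w k · (g k · ĝ (suc k))

    -- λ⁻ belongs to the top and the right vertex of a cell, μ⁺ to the left and the
    -- bottom one, so that the factors of a vertex shared by two cells cancel.
    λ⁻ μ⁺ : ℕ → Bool → R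
    λ⁻ k b = if b then 1# else ĝ k
    μ⁺ k b = if b then g k else 1#

    Λ M⁺ : ℕ → ∀ {n} → Vec Bool n → R
    Λ k []      = 1#
    Λ k (b ∷ a) = λ⁻ k b · Λ (suc k) a
    M⁺ k []      = 1#
    M⁺ k (b ∷ a) = μ⁺ k b · M⁺ (suc k) a

    private
      cancel : ∀ k p → (g k · ĝ k) · p ≡ p
      cancel k p = trans (cong (_· p) (g·ĝ≡1 k)) (*-identityˡ p)

      1+ŵx̂ : ∀ k → 1# ⊕ ŵ k · x̂ k ≡ g k · g (suc k)
      1+ŵx̂ k = trans (cong (1# ⊕_) (trans
        (solve 6 (λ x w g h g′ h′ → (w :* (g :* h′)) :* (x :* (g′ :* h)) :=
          (g :* h) :* ((g′ :* h′) :* (x :* w))) refl (x k) (w k) (g k) (ĝ k) (g (suc k)) (ĝ (suc k)))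
        (trans (cancel k _) (cancel (suc k) _)))) (1+xw≡gg k)

      -- Urban renewal of a single cell. The right vertex enters through the factor which it has as
      -- the left vertex of the next cell.
      κ-renewal : ∀ k a b s → κ (x k) (w k) a b s · μ⁺ (suc k) (next a b s) ≡
        ((λ⁻ k a · μ⁺ (suc k) b) · μ⁺ k s) · κ (ŵ k) (x̂ k) (not a) (not b) (not s)
      κ-renewal k false false true = trans (zeroˡ _) (sym (zeroʳ _))
      κ-renewal k true  false true = sym (trans
        (solve 4 (λ x g h g′ → ((con 1 :* con 1) :* g) :* (x :* (g′ :* h)) := (g :* h) :* (x :* g′)) refl
          (x k) (g k) (ĝ k) (g (suc k)))
        (cancel k _))
      κ-renewal k false true  true = sym (trans
        (solve 3 (λ g h g′ → ((h :* g′) :* g) :* con 1 := (g :* h) :* (con 1 :* g′)) refl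
          (g k) (ĝ k) (g (suc k)))
        (cancel k _))
      κ-renewal k true  true  true = trans (cong (_· 1#) (1+xw≡gg k))
        (solve 2 (λ g g′ → (g :* g′) :* con 1 := ((con 1 :* g′) :* g) :* con 1) refl (g k) (g (suc k)))
      κ-renewal k false false false = sym (trans (cong (((ĝ k · 1#) · 1#) ·_) (1+ŵx̂ k)) (trans
        (solve 3 (λ g h g′ → ((h :* con 1) :* con 1) :* (g :* g′) := (g :* h) :* (con 1 :* g′)) refl
          (g k) (ĝ k) (g (suc k)))
        (cancel k _)))
      κ-renewal k true  false false = sym (cong (_· 1#) (trans (*-identityʳ _) (*-identityˡ 1#)))
      κ-renewal k false true  false = sym (trans
        (solve 5 (λ w g h g′ h′ → ((h :* g′) :* con 1) :* (w :* (g :* h′)) :=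
          (g :* h) :* ((g′ :* h′) :* (w :* con 1))) refl (w k) (g k) (ĝ k) (g (suc k)) (ĝ (suc k)))
        (trans (cancel k _) (cancel (suc k) _)))
      κ-renewal k true  true  false = trans (zeroˡ _) (sym (zeroʳ _))

      next-not : ∀ a b s → next (not a) (not b) (not s) ≡ not (next a b s)
      next-not false false false = refl
      next-not false false true  = refl
      next-not false true  false = refl
      next-not false true  true  = refl
      next-not true  false false = refl
      next-not true  false true  = refl
      next-not true  true  false = refl
      next-not true  true  true  = refl

    -- The factors of shared vertices v telescope along the row; those of the top and bottom
    -- vertices and of the leftmost v remain.
    renewal : ∀ k {n} (a b : Vec Bool n) s →
      C x w false k a b s ≡ (Λ k a · M⁺ (suc k) b) · (μ⁺ k s · C ŵ x̂ true k (¬ᵛ a) (¬ᵛ b) (not s))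
    renewal k [] [] false = solve 0 (con 1 := (con 1 :* con 1) :* (con 1 :* con 1)) refl
    renewal k [] [] true  = sym (trans (cong ((1# · 1#) ·_) (zeroʳ _)) (zeroʳ _))
    renewal k (a ∷ as) (b ∷ bs) s = begin
      κ₀ · C x w false (suc k) as bs t
        ≡⟨ cong (κ₀ ·_) (renewal (suc k) as bs t) ⟩
      κ₀ · ((Λ (suc k) as · M⁺ (suc (suc k)) bs) · (μ⁺ (suc k) t · C′ (not t)))
        ≡⟨ solve 5 (λ p l m q c → p :* ((l :* m) :* (q :* c)) := (p :* q) :* ((l :* m) :* c)) refl _ _ _ _ _ ⟩
      (κ₀ · μ⁺ (suc k) t) · ((Λ (suc k) as · M⁺ (suc (suc k)) bs) · C′ (not t))
        ≡⟨ cong (_· ((Λ (suc k) as · M⁺ (suc (suc k)) bs) · C′ (not t))) (κ-renewal k a b s) ⟩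
      (((λ⁻ k a · μ⁺ (suc k) b) · μ⁺ k s) · κ₁) · ((Λ (suc k) as · M⁺ (suc (suc k)) bs) · C′ (not t))
        ≡⟨ solve 7 (λ p q r u l m c → (((p :* q) :* r) :* u) :* ((l :* m) :* c) :=
             ((p :* l) :* (q :* m)) :* (r :* (u :* c))) refl _ _ _ _ _ _ _ ⟩
      (Λ k (a ∷ as) · M⁺ (suc k) (b ∷ bs)) · (μ⁺ k s · (κ₁ · C′ (not t)))
        ≡⟨ cong (λ t → (Λ k (a ∷ as) · M⁺ (suc k) (b ∷ bs)) · (μ⁺ k s · (κ₁ · C′ t)))
             (next-not a b s) ⟨
      (Λ k (a ∷ as) · M⁺ (suc k) (b ∷ bs)) · (μ⁺ k s · (κ₁ · C′ (next (not a) (not b) (not s)))) ∎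
      where
      t  = next a b s
      κ₀ = κ (x k) (w k) a b s
      κ₁ = κ (ŵ k) (x̂ k) (not a) (not b) (not s)
      C′ = C ŵ x̂ true (suc k) (¬ᵛ as) (¬ᵛ bs)

    private
      -- The factors that a vertex u between two rows receives from above and from below cancel.
      Λ·M⁺ : ∀ k {n} (b : Vec Bool n) → Λ k (¬ᵛ b) · M⁺ k b ≡ 1#
      Λ·M⁺ k []          = *-identityˡ 1#
      Λ·M⁺ k (true ∷ b)  = trans
        (solve 4 (λ g h l m → (h :* l) :* (g :* m) := (g :* h) :* (l :* m)) refl (g k) _ _ _)
        (trans (cancel k _) (Λ·M⁺ (suc k) b))
      Λ·M⁺ k (false ∷ b) = trans
        (cong₂ _·_ (*-identityˡ _) (*-identityˡ _)) (Λ·M⁺ (suc k) b)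

      -- Only the all-`false` vector counts on the lowest line, where `Λ` consists of the inverses
      -- of all the factors.
      Λ·product : ∀ k {n} (a : Vec Bool n) →
                  none a ≡ (Λ k a · product g k n) · none (¬ᵛ (¬ᵛ a))
      Λ·product k []          = solve 0 (con 1 := (con 1 :* con 1) :* con 1) refl
      Λ·product k (true ∷ a)  = sym (zeroʳ _)
      Λ·product k (false ∷ a) = trans (Λ·product (suc k) a) (sym (trans
        (solve 5 (λ g h l p z → ((h :* l) :* (g :* p)) :* z := (g :* h) :* ((l :* p) :* z)) refl
          (g k) _ _ _ _)
        (cancel k _)))

    Λ-all : ∀ k n → Λ k (replicate n true) ≡ 1#
    Λ-all k zero    = refl
    Λ-all k (suc n) = trans (*-identityˡ _) (Λ-all (suc k) n)

    -- The r leftmost vertices v and the n lowest vertices u supply the product; besides it only the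
    -- factors `Λ k a` of the topmost line survive.
    Z≡Z′ : ∀ r k {n} (a : Vec Bool n) →
           Z x w r k a ≡ (Λ k a · product g k (r + n)) · Z′ ŵ x̂ r k (¬ᵛ a)
    Z≡Z′ zero    k     a = Λ·product k a
    Z≡Z′ (suc r) k {n} a = trans (Σ-·-cong n (Λ k a · product g k (suc r + n)) summand)
      (cong ((Λ k a · product g k (suc r + n)) ·_)
        (Σ-¬ n (λ b → C ŵ x̂ true k (¬ᵛ a) b false · Z′ ŵ x̂ r (suc k) (¬ᵛ b))))
      where
      summand : ∀ b → Row x w k a b · Z x w r (suc k) (¬ᵛ b) ≡
        (Λ k a · (g k · product g (suc k) (r + n))) ·
        (C ŵ x̂ true k (¬ᵛ a) (¬ᵛ b) false · Z′ ŵ x̂ r (suc k) (¬ᵛ (¬ᵛ b)))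
      summand b = begin
        Row x w k a b · Z x w r (suc k) (¬ᵛ b)
          ≡⟨ cong₂ _·_ (trans (Row≡C x w k a b) (renewal k a b true)) (Z≡Z′ r (suc k) (¬ᵛ b)) ⟩
        ((Λ k a · M⁺ (suc k) b) · (g k · C′)) · ((Λ (suc k) (¬ᵛ b) · Π) · Z″)
          ≡⟨ solve 7 (λ l m g c l′ p z → ((l :* m) :* (g :* c)) :* ((l′ :* p) :* z) :=
               (l′ :* m) :* ((l :* (g :* p)) :* (c :* z))) refl _ _ _ _ _ _ _ ⟩
        (Λ (suc k) (¬ᵛ b) · M⁺ (suc k) b) · ((Λ k a · (g k · Π)) · (C′ · Z″))
          ≡⟨ trans (cong (_· ((Λ k a · (g k · Π)) · (C′ · Z″))) (Λ·M⁺ (suc k) b)) (*-identityˡ _) ⟩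
        (Λ k a · (g k · Π)) · (C′ · Z″) ∎
        where
        C′ = C ŵ x̂ true k (¬ᵛ a) (¬ᵛ b) false
        Z″ = Z′ ŵ x̂ r (suc k) (¬ᵛ (¬ᵛ b))
        Π  = product g (suc k) (r + n)

  -- Regrouping: the lower half of a row of cells and the upper half of the next one
  -- form a row of cells of the smaller Aztec diamond, with u and v interchanged.
  module _ (x w : ℕ → R) where

    x₂ : ℕ → R
    x₂ k = x (suc (suc k))

    -- Here the cut runs through the shared vertices v of a row, between its two halves: `a` selects
    -- those left to the lower half.
    Y : ℕ → ℕ → ∀ {n} → Vec Bool n → R
    Y r k {n} a = Σ (suc n) λ b → H w one k false a b · Z′ x w r (suc k) (¬ᵛ b)

    Z′-suc : ∀ r k {n} (a : Vec Bool (suc n)) →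
             Z′ x w (suc r) k a ≡ Σ n λ m → H one (x ∘ suc) k false m a · Y r k (¬ᵛ m)
    Z′-suc r k {n} a = begin
      Σ (suc n) (λ b → C x w true k a b false · Z″ b)
        ≡⟨ Σ-cong (suc n) (λ b → begin
             C x w true k a b false · Z″ b                        ≡⟨ cong (_· Z″ b) (C≡Q₀ x w k a b) ⟩
             Q x w k false false a b · Z″ b                       ≡⟨ *-comm _ _ ⟩
             Z″ b · Q x w k false false a b                       ≡⟨ Σ-· n (Z″ b) _ ⟨
             Σ n (λ m → Z″ b · (above m · below m b))
               ≡⟨ Σ-cong n (λ m → solve 3 (λ z a b → z :* (a :* b) := a :* (b :* z)) refl _ _ _) ⟩
             Σ n (λ m → above m · (below m b · Z″ b))             ∎) ⟩
      Σ (suc n) (λ b → Σ n (λ m → above m · (below m b · Z″ b)))  ≡⟨ Σ-swap (suc n) n _ ⟩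
      Σ n (λ m → Σ (suc n) (λ b → above m · (below m b · Z″ b)))  ≡⟨ Σ-cong n (λ m → Σ-· (suc n) (above m) _) ⟩
      Σ n (λ m → above m · Y r k (¬ᵛ m))                          ∎
      where
      above : Vec Bool n → R
      above m = H one (x ∘ suc) k false m a
      below : Vec Bool n → Vec Bool (suc n) → R
      below m b = H w one k false (¬ᵛ m) b
      Z″ : Vec Bool (suc n) → R
      Z″ b = Z′ x w r (suc k) (¬ᵛ b)

    Y≡Z : ∀ r k {n} (a : Vec Bool n) → Y r k a ≡ Z w x₂ r k a
    Y≡Z zero    k {n} a = trans
      (Σ-cong (suc n) λ b → trans
        (cong (λ b′ → H w one k false a b · none b′) (¬ᵛ-involutive b)) (*-comm _ _))
      (trans (Σ-none (suc n) (H w one k false a)) (H-none w one k a))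
    Y≡Z (suc r) k {n} a = begin
      Σ (suc n) (λ b → above b · Z′ x w (suc r) (suc k) (¬ᵛ b))
        ≡⟨ Σ-cong (suc n) (λ b → trans (cong (above b ·_) (Z′-suc r (suc k) (¬ᵛ b))) (sym (Σ-· n (above b) _))) ⟩
      Σ (suc n) (λ b → Σ n (λ m → above b · (below m b · Y r (suc k) (¬ᵛ m))))
        ≡⟨ Σ-swap (suc n) n _ ⟩
      Σ n (λ m → Σ (suc n) (λ b → above b · (below m b · Y r (suc k) (¬ᵛ m))))
        ≡⟨ Σ-cong n (λ m → trans
             (Σ-·-cong (suc n) (Y r (suc k) (¬ᵛ m)) (λ b → trans
               -- This half row comes from the next row of cells, where the index is larger by 1;
               -- together with `x ∘ suc` this gives the shift by 2 in `x₂`.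
               (cong (λ h → above b · (h · Y r (suc k) (¬ᵛ m))) (H-shift one (x ∘ suc) k false m (¬ᵛ b)))
               (solve 3 (λ a b y → a :* (b :* y) := y :* (a :* b)) refl _ _ _)))
             (trans (*-comm _ _) (cong (Row w x₂ k a m ·_) (Y≡Z r (suc k) (¬ᵛ m))))) ⟩
      Σ n (λ m → Row w x₂ k a m · Z w x₂ r (suc k) (¬ᵛ m)) ∎
      where
      above : Vec Bool (suc n) → R
      above = H w one k false a
      below : Vec Bool n → Vec Bool (suc n) → R
      below m b = H one (x ∘ suc) (suc k) false m (¬ᵛ b)

    -- As no vertex of the topmost line is to be covered, the uppermost half row is empty, and all
    -- shared vertices v of the first row are left to its lower half.
    Z′≡Z : ∀ n → Z′ x w (suc n) 0 (replicate (suc n) false) ≡ Z w x₂ n 0 (replicate n true)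
    Z′≡Z n = begin
      Z′ x w (suc n) 0 (replicate (suc n) false)
        ≡⟨ Z′-suc n 0 _ ⟩
      Σ n (λ m → H one (x ∘ suc) 0 false m (replicate (suc n) false) · Y n 0 (¬ᵛ m))
        ≡⟨ Σ-cong n (λ m → cong (_· Y n 0 (¬ᵛ m)) (H-none one (x ∘ suc) 0 m)) ⟩
      Σ n (λ m → none m · Y n 0 (¬ᵛ m))
        ≡⟨ Σ-none n (Y n 0 ∘ ¬ᵛ) ⟩
      Y n 0 (¬ᵛ (replicate n false))
        ≡⟨ cong (Y n 0) (map-replicate not false n) ⟩
      Y n 0 (replicate n true)
        ≡⟨ Y≡Z n 0 _ ⟩
      Z w x₂ n 0 (replicate n true) ∎

  -- The reduction of the order by one

  𝒵 : (x w : ℕ → R) → ℕ → R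
  𝒵 x w n = Z x w n 0 (replicate n true)

  Z-cong : ∀ {x x′ w w′} → (∀ k → x k ≡ x′ k) → (∀ k → w k ≡ w′ k) →
           ∀ r k {n} (a : Vec Bool n) → Z x w r k a ≡ Z x′ w′ r k a
  Z-cong x≗x′ w≗w′ zero    k     a = refl
  Z-cong x≗x′ w≗w′ (suc r) k {n} a = Σ-cong n λ b → cong₂ _·_
    (Σ-cong (suc n) λ m → cong₂ _·_
      (H-cong k k (λ j → x≗x′ (j + k)) (λ _ → refl) false a m)
      (H-cong k k (λ _ → refl) (λ j → w≗w′ (j + k)) false b (¬ᵛ m)))
    (Z-cong x≗x′ w≗w′ r (suc k) (¬ᵛ b))

  𝒵-cong : ∀ {x x′ w w′} → (∀ k → x k ≡ x′ k) → (∀ k → w k ≡ w′ k) → ∀ n → 𝒵 x w n ≡ 𝒵 x′ w′ n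
  𝒵-cong x≗x′ w≗w′ n = Z-cong x≗x′ w≗w′ n 0 (replicate n true)

  -- The reduction theorem: urban renewal in every cell, followed by the rescaling
  -- at the vertices which makes the edges of weight 1 again have weight 1.
  reduction : ∀ x w g ĝ → (∀ k → g k · ĝ k ≡ 1#) →
              (∀ k → 1# ⊕ x k · w k ≡ g k · g (suc k)) → ∀ n →
              𝒵 x w (suc n) ≡ product g 0 (suc n + suc n) ·
                𝒵 (λ k → x k · (g (1 + k) · ĝ k))
                  (λ k → w (2 + k) · (g (2 + k) · ĝ (3 + k))) n
  reduction x w g ĝ g·ĝ≡1 1+xw≡gg n = begin
    𝒵 x w (suc n)
      ≡⟨ Z≡Z′ x w g ĝ g·ĝ≡1 1+xw≡gg (suc n) 0 (replicate (suc n) true) ⟩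
    (Λ x w g ĝ g·ĝ≡1 1+xw≡gg 0 (replicate (suc n) true) · Π) · Z″ (¬ᵛ (replicate (suc n) true))
      ≡⟨ cong₂ (λ l a → (l · Π) · Z″ a)
           (Λ-all x w g ĝ g·ĝ≡1 1+xw≡gg 0 (suc n)) (map-replicate not true (suc n)) ⟩
    (1# · Π) · Z″ (replicate (suc n) false)
      ≡⟨ cong₂ _·_ (*-identityˡ Π) (Z′≡Z x′ w′ n) ⟩
    Π · 𝒵 w′ (λ k → x′ (2 + k)) n ∎
    where
    x′ w′ : ℕ → R
    x′ k = w k · (g k · ĝ (suc k))
    w′ k = x k · (g (suc k) · ĝ k)
    Z″ = Z′ x′ w′ (suc n) 0
    Π  = product g 0 (suc n + suc n)

  -- Perfect matchings counted by weighted sums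

  Σ-++ : ∀ m n (F : Vec Bool (m + n) → R) → Σ (m + n) F ≡ Σ m λ a → Σ n λ b → F (a ++ b)
  Σ-++ zero    n F = sym (Σ-0 _)
  Σ-++ (suc m) n F = trans (Σ-suc (m + n) F)
    (trans (cong₂ _⊕_ (Σ-++ m n (F ∘ (true ∷_))) (Σ-++ m n (F ∘ (false ∷_)))) (sym (Σ-suc m _)))

  Σ-single : ∀ n a {F : Vec Bool n → R} → (∀ b → b ≢ a → F b ≡ 0#) → Σ n F ≡ F a
  Σ-single zero    []          F≗0 = Σ-0 _
  Σ-single (suc n) (true ∷ a)  F≗0 = trans (Σ-suc n _) (trans
    (cong₂ _⊕_ (Σ-single n a λ b b≢a → F≗0 (true ∷ b) λ { refl → b≢a refl })
               (Σ-zero n λ b → F≗0 (false ∷ b) λ ()))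
    (+-identityʳ _))
  Σ-single (suc n) (false ∷ a) F≗0 = trans (Σ-suc n _) (trans
    (cong₂ _⊕_ (Σ-zero n λ b → F≗0 (true ∷ b) λ ())
               (Σ-single n a λ b b≢a → F≗0 (false ∷ b) λ { refl → b≢a refl }))
    (+-identityˡ _))

  χ : Bool → R
  χ true  = 1#
  χ false = 0#

  χ-∧ : ∀ b c → χ (b ∧ c) ≡ χ b · χ c
  χ-∧ true  c = sym (*-identityˡ _)
  χ-∧ false c = sym (zeroˡ _)

  χ-true : ∀ b → T b → χ b ≡ 1#
  χ-true true _ = refl

  χ-false : ∀ b → ¬ T b → χ b ≡ 0#
  χ-false true  ¬t = ⊥-elim (¬t tt)
  χ-false false _  = refl

  Σ-unique : ∀ {Q : Set} m n (f : Vec Bool m → Vec Bool n → Bool) (d : Dec Q) →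
             (Q → ∃₂ λ a b → T (f a b)) → (∀ a b → T (f a b) → Q) →
             (∀ a b a′ b′ → T (f a b) → T (f a′ b′) → a ≡ a′ × b ≡ b′) →
             χ (does d) ≡ Σ m λ a → Σ n λ b → χ (f a b)
  Σ-unique m n f (yes q) witness sound unique with a₀ , b₀ , t ← witness q = sym (begin
    Σ m (λ a → Σ n λ b → χ (f a b))
      ≡⟨ Σ-single m a₀ (λ a a≢a₀ → Σ-zero n λ b → χ-false _ λ t′ → a≢a₀ (proj₁ (unique _ _ _ _ t′ t))) ⟩
    Σ n (λ b → χ (f a₀ b))
      ≡⟨ Σ-single n b₀ (λ b b≢b₀ → χ-false _ λ t′ → b≢b₀ (proj₂ (unique _ _ _ _ t′ t))) ⟩
    χ (f a₀ b₀)
      ≡⟨ χ-true _ t ⟩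
    1# ∎)
  Σ-unique m n f (no ¬q) witness sound unique =
    sym (Σ-zero m λ a → Σ-zero n λ b → χ-false _ λ t → ¬q (sound a b t))

  Σ-half : ∀ p q k c {n} (a : Vec Bool n) m →
           Σ (n * 2) (λ row → χ (half p q k c row a m)) ≡ H (χ ∘ p) (χ ∘ q) k c a m
  Σ-half p q k true  [] (true ∷ [])  = Σ-0 _
  Σ-half p q k true  [] (false ∷ []) = Σ-0 _
  Σ-half p q k false [] (true ∷ [])  = Σ-0 _
  Σ-half p q k false [] (false ∷ []) = Σ-0 _
  Σ-half p q k c {suc n} (a ∷ as) (m ∷ ms) = trans (Σ-suc _ _) (trans
    (cong₂ _⊕_ (Σ-suc (n * 2) _) (Σ-suc (n * 2) _)) (by-cases c a m))
    where
    F : (c a m e f : Bool) → R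
    F c a m e f = Σ (n * 2) λ row → χ (half p q k c (e ∷ f ∷ row) (a ∷ as) (m ∷ ms))

    Σ0 : Σ (n * 2) (λ _ → 0#) ≡ 0#
    Σ0 = Σ-zero (n * 2) λ _ → refl

    allow : ∀ b c → Σ (n * 2) (λ row → χ (b ∧ half p q (suc k) c row as ms)) ≡
                    χ b · H (χ ∘ p) (χ ∘ q) (suc k) c as ms
    allow b c = trans (Σ-·-cong (n * 2) (χ b) λ row → χ-∧ b _)
                      (cong (χ b ·_) (Σ-half p q (suc k) c as ms))

    zero-sum : ∀ {s t u v} → s ≡ 0# → t ≡ 0# → u ≡ 0# → v ≡ 0# → (s ⊕ t) ⊕ (u ⊕ v) ≡ 0#
    zero-sum refl refl refl refl = solve 0 ((con 0 :+ con 0) :+ (con 0 :+ con 0) := con 0) refl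

    second : ∀ {s t u v r} → s ≡ 0# → t ≡ r → u ≡ 0# → v ≡ 0# → (s ⊕ t) ⊕ (u ⊕ v) ≡ r
    second {r = r} refl refl refl refl =
      solve 1 (λ r → (con 0 :+ r) :+ (con 0 :+ con 0) := r) refl r

    third : ∀ {s t u v r} → s ≡ 0# → t ≡ 0# → u ≡ r → v ≡ 0# → (s ⊕ t) ⊕ (u ⊕ v) ≡ r
    third {r = r} refl refl refl refl =
      solve 1 (λ r → (con 0 :+ con 0) :+ (r :+ con 0) := r) refl r

    fourth : ∀ {s t u v r} → s ≡ 0# → t ≡ 0# → u ≡ 0# → v ≡ r → (s ⊕ t) ⊕ (u ⊕ v) ≡ r
    fourth {r = r} refl refl refl refl =
      solve 1 (λ r → (con 0 :+ con 0) :+ (con 0 :+ r) := r) refl r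

    -- At most one of the four choices for the two edges of the first cell passes the degree tests,
    -- and using both edges never does.
    by-cases : ∀ c a m → (F c a m true true ⊕ F c a m true false) ⊕
                         (F c a m false true ⊕ F c a m false false) ≡
                         H (χ ∘ p) (χ ∘ q) k c (a ∷ as) (m ∷ ms)
    by-cases false false false = fourth Σ0 Σ0 Σ0 (Σ-half p q (suc k) false as ms)
    by-cases false false true  = zero-sum Σ0 Σ0 Σ0 Σ0
    by-cases true  false false = zero-sum Σ0 Σ0 Σ0 Σ0
    by-cases true  false true  = fourth Σ0 Σ0 Σ0 (Σ-half p q (suc k) false as ms)
    by-cases false true  false = third Σ0 Σ0 (allow (q k) true) Σ0
    by-cases false true  true  = second Σ0 (allow (p k) false) Σ0 Σ0
    by-cases true  true  false = zero-sum Σ0 Σ0 Σ0 Σ0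
    by-cases true  true  true  = third Σ0 Σ0 (allow (q k) true) Σ0

  private
    none-dec : ∀ {Q : Set} {n} (a : Vec Bool n) (d : Dec Q) → (Q → ∀ j → 0 ≡ bit (lookup a j)) →
               ((∀ j → 0 ≡ bit (lookup a j)) → Q) → χ (does d) ≡ none a
    none-dec []          d ⇒ ⇐ = χ-true _ (dec-T d (⇐ λ ()))
    none-dec (true ∷ a)  d ⇒ ⇐ = χ-false _ λ t → case ⇒ (T-dec d t) zero of λ ()
    none-dec (false ∷ a) d ⇒ ⇐ = none-dec a d (λ q j → ⇒ q (suc j))
      (λ h → ⇐ λ { zero → refl ; (suc j) → h j })

    Σ-swap₂ : ∀ m n p (F : Vec Bool m → Vec Bool n → Vec Bool p → R) →
              Σ m (λ a → Σ n λ b → Σ p λ c → F a b c) ≡ Σ n λ b → Σ p λ c → Σ m λ a → F a b c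
    Σ-swap₂ m n p F = trans (Σ-swap m n _) (Σ-cong n λ b → Σ-swap m p _)

  -- The indicator of a matching is expanded over the choices `b` and `m`. Once these are summed
  -- outermost, the two half rows and the remaining rows vary independently, and the sum factors.
  Σ-matching : ∀ x w r k {n} (a : Vec Bool n) →
    Σ (r * 2 * (n * 2)) (λ S → χ (does (matching? x w r n k S a))) ≡ Z (χ ∘ x) (χ ∘ w) r k a
  Σ-matching x w zero    k     a = trans (Σ-0 _) (none-dec a (matching? x w 0 _ k [] a)
    Matching.degᵘ₀ (λ h → mkMatching h (λ ()) (λ ()) refl))
  Σ-matching x w (suc r) k {n} a = begin
    Σ (N + (N + L)) (λ S → χ (does (matching? x w (suc r) n k S a)))
      ≡⟨ trans (Σ-++ N (N + L) _) (Σ-cong N λ row₁ → Σ-++ N L _) ⟩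
    Σ N (λ row₁ → Σ N λ row₂ → Σ L λ S → χ (does (matching? x w (suc r) n k (row₁ ++ (row₂ ++ S)) a)))
      ≡⟨ (Σ-cong N λ row₁ → Σ-cong N λ row₂ → Σ-cong L λ S →
           Σ-unique n (suc n) (matching-step x w {r} {n} row₁ row₂ S k a) (matching? x w (suc r) n k _ a)
             (Matching⇒step x w {r} {n} row₁ row₂ S k a) (step⇒Matching x w {r} {n} row₁ row₂ S k a)
             (step-unique x w {r} {n} row₁ row₂ S k a)) ⟩
    Σ N (λ row₁ → Σ N λ row₂ → Σ L λ S → Σ n λ b → Σ (suc n) λ m →
      χ (matching-step x w {r} {n} row₁ row₂ S k a b m))
      ≡⟨ (Σ-cong N λ row₁ → trans (Σ-cong N λ row₂ → Σ-swap₂ L n (suc n) _) (Σ-swap₂ N n (suc n) _)) ⟩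
    Σ N (λ row₁ → Σ n λ b → Σ (suc n) λ m → Σ N λ row₂ → Σ L λ S →
      χ (matching-step x w {r} {n} row₁ row₂ S k a b m))
      ≡⟨ Σ-swap₂ N n (suc n) _ ⟩
    Σ n (λ b → Σ (suc n) λ m → Σ N λ row₁ → Σ N λ row₂ → Σ L λ S →
      χ (matching-step x w {r} {n} row₁ row₂ S k a b m))
      ≡⟨ (Σ-cong n λ b → trans
           (Σ-·-cong (suc n) (Z (χ ∘ x) (χ ∘ w) r (suc k) (¬ᵛ b)) λ m → factor b m) (*-comm _ _)) ⟩
    Σ n (λ b → ρ b · Z (χ ∘ x) (χ ∘ w) r (suc k) (¬ᵛ b)) ∎
    where
    N = n * 2
    L = r * 2 * (n * 2)
    ρ : Vec Bool n → R
    ρ b = Row (χ ∘ x) (χ ∘ w) k a b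

    factor : ∀ b m →
      Σ N (λ row₁ → Σ N λ row₂ → Σ L λ S → χ (matching-step x w {r} {n} row₁ row₂ S k a b m)) ≡
      Z (χ ∘ x) (χ ∘ w) r (suc k) (¬ᵛ b) ·
        (H (χ ∘ x) one k false a m · H one (χ ∘ w) k false b (¬ᵛ m))
    factor b m = begin
      Σ N (λ row₁ → Σ N λ row₂ → Σ L λ S → χ ((h₁ row₁ ∧ h₂ row₂) ∧ d S))
        ≡⟨ (Σ-cong N λ row₁ → Σ-cong N λ row₂ → trans
             (Σ-·-cong L (χ (h₁ row₁) · χ (h₂ row₂)) λ S →
               trans (χ-∧ _ (d S)) (cong (_· χ (d S)) (χ-∧ (h₁ row₁) (h₂ row₂))))
             (cong ((χ (h₁ row₁) · χ (h₂ row₂)) ·_) (Σ-matching x w r (suc k) (¬ᵛ b)))) ⟩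
      Σ N (λ row₁ → Σ N λ row₂ → (χ (h₁ row₁) · χ (h₂ row₂)) · z)
        ≡⟨ (Σ-cong N λ row₁ → trans
             (Σ-·-cong N (z · χ (h₁ row₁)) λ row₂ →
               solve 3 (λ p q z → (p :* q) :* z := (z :* p) :* q) refl _ _ _)
             (cong ((z · χ (h₁ row₁)) ·_) (Σ-half always w k false b (¬ᵛ m)))) ⟩
      Σ N (λ row₁ → (z · χ (h₁ row₁)) · H₂)
        ≡⟨ trans (Σ-·-cong N (z · H₂) λ row₁ →
               solve 3 (λ z p h → (z :* p) :* h := (z :* h) :* p) refl _ _ _)
             (cong ((z · H₂) ·_) (Σ-half x always k false a m)) ⟩
      (z · H₂) · H₁
        ≡⟨ solve 3 (λ z p h → (z :* h) :* p := z :* (p :* h)) refl _ _ _ ⟩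
      z · (H₁ · H₂) ∎
      where
      h₁ h₂ : Vec Bool N → Bool
      h₁ row = half x always k false row a m
      h₂ row = half always w k false row b (¬ᵛ m)
      d : Vec Bool L → Bool
      d S = does (matching? x w r n (suc k) S (¬ᵛ b))
      z  = Z (χ ∘ x) (χ ∘ w) r (suc k) (¬ᵛ b)
      H₁ = H (χ ∘ x) one k false a m
      H₂ = H one (χ ∘ w) k false b (¬ᵛ m)

  -- Opaque, lest the type checker computes ι (3 ^ k) in unary.
  opaque
    ι : ℕ → R
    ι n = n ×ₙ 1#

    ι≡× : ∀ n → ι n ≡ n ×ₙ 1#
    ι≡× n = refl

    ι-+ : ∀ m n → ι (m + n) ≡ ι m ⊕ ι n
    ι-+ = ×-homo-+ 1#

    ι-* : ∀ m n → ι (m * n) ≡ ι m · ι n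
    ι-* = ×1-homo-*

    ι-0 : ι 0 ≡ 0#
    ι-0 = refl

    ι-1 : ι 1 ≡ 1#
    ι-1 = +-identityʳ 1#

  ι-count : ∀ n {P : Pred (Vec Bool n) 0ℓ} (P? : Decidable P) →
            ι (length (filter P? (allSubsets n))) ≡ Σ n λ S → χ (does (P? S))
  ι-count zero    P? = trans ι-filter (sym (Σ-0 _))
    where
    ι-filter : ι (length (filter P? ([] ∷ []))) ≡ χ (does (P? []))
    ι-filter with does (P? [])
    ... | true  = ι-1
    ... | false = ι-0
  ι-count (suc n) P? = trans
    (cong ι (trans (cong length (List.filter-++ P? (List.map (true ∷_) (allSubsets n)) _))
                   (List.length-++ (filter P? (List.map (true ∷_) (allSubsets n))))))
    (trans (ι-+ (length (filter P? (List.map (true ∷_) (allSubsets n)))) _)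
    (trans (cong₂ _⊕_ (part true) (part false)) (sym (Σ-suc n _))))
    where
    part : ∀ b → ι (length (filter P? (List.map (b ∷_) (allSubsets n)))) ≡ Σ n λ S → χ (does (P? (b ∷ S)))
    part b = trans (cong ι (filter-map b (allSubsets n))) (ι-count n (P? ∘ (b ∷_)))
      where
      filter-map : ∀ b L → length (filter P? (List.map (b ∷_) L)) ≡ length (filter (P? ∘ (b ∷_)) L)
      filter-map b []      = refl
      filter-map b (S ∷ L) with does (P? (b ∷ S))
      ... | true  = cong suc (filter-map b L)
      ... | false = filter-map b L

  module _ {n} (S : Subset (n * 2 * (n * 2))) where

    exactlyOne⇔count : ∀ (x : Vertex n) → ExactlyOne (λ e → e ∈ S × Incident n x e) ⇔
                       count S (λ e → does (incident? n x e)) ≡ 1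
    exactlyOne⇔count x = mk⇔
      (λ (e , (e∈S , h) , unique) → from (count≡1⇔ S _) (e , ([]=⇒lookup e∈S , dec-true (incident? n x e) h) ,
        λ f (f∈S , g) → unique f (lookup⇒[]= f S f∈S , does⇒ f g)))
      (λ c → let (e , (e∈S , h) , unique) = to (count≡1⇔ S _) c in
        e , (lookup⇒[]= e S e∈S , does⇒ e h) ,
        λ f (f∈S , g) → unique f ([]=⇒lookup f∈S , dec-true (incident? n x f) g))
      where
      does⇒ : ∀ e → does (incident? n x e) ≡ true → Incident n x e
      does⇒ e h = T-dec (incident? n x e) (subst T (sym h) tt)

    count-u : ∀ i j → count S (λ e → does (incident? n (u i j) e)) ≡ countₛ n n S (at-u i j)
    -- For a vertex u the impossible disjunct of incidence is the right one, where `_∨_` is stuck;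
    -- for a vertex v it is the left one, and the two counts agree by computation.
    count-u i j = count-cong S λ e → ∨-identityʳ _

    isPerfectMatching⇔Matching : IsPerfectMatching n (B n) S ⇔ Matching x₀ w₀ n n 0 S (replicate n true)
    isPerfectMatching⇔Matching = mk⇔
      (λ (S⊆B , h) → mkMatching
        (λ j → trans (deg-u h zero j) (cong bit (sym (lookup-replicate j true))))
        (λ i j → deg-u h (suc i) j)
        (λ i j → to (exactlyOne⇔count (v i j)) (h (v i j)))
        (from (count≡0⇔ S _) λ e e∈S → not-injective (trans (sym (B-entry n e))
          ([]=⇒lookup (S⊆B (lookup⇒[]= e S e∈S))))))
      (λ (mkMatching hᵘ₀ hᵘ₊ hᵛ hᵃ) →
        (λ {e} e∈S → lookup⇒[]= e (B n) (trans (B-entry n e)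
          (cong not (to (count≡0⇔ S _) hᵃ e ([]=⇒lookup e∈S))))) ,
        λ { (u zero j)    → from (exactlyOne⇔count (u zero j)) (trans (count-u zero j)
                              (trans (hᵘ₀ j) (cong bit (lookup-replicate j true))))
          ; (u (suc i) j) → from (exactlyOne⇔count (u (suc i) j)) (trans (count-u (suc i) j) (hᵘ₊ i j))
          ; (v i j)       → from (exactlyOne⇔count (v i j)) (hᵛ i j) })
      where
      deg-u : (∀ x → ExactlyOne (λ e → e ∈ S × Incident n x e)) → ∀ i j → countₛ n n S (at-u i j) ≡ 1
      deg-u h i j = trans (sym (count-u i j)) (to (exactlyOne⇔count (u i j)) (h (u i j)))

  ι-M : ∀ n → ι (M n (B n)) ≡ 𝒵 (χ ∘ x₀) (χ ∘ w₀) n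
  ι-M n = begin
    ι (M n (B n))
      ≡⟨ ι-count (n * 2 * (n * 2)) (isPerfectMatching? n (B n)) ⟩
    Σ (n * 2 * (n * 2)) (λ S → χ (does (isPerfectMatching? n (B n) S)))
      ≡⟨ Σ-cong (n * 2 * (n * 2)) (λ S → cong χ (does-⇔ (isPerfectMatching⇔Matching S)
           (isPerfectMatching? n (B n) S) (matching? x₀ w₀ n n 0 S (replicate n true)))) ⟩
    Σ (n * 2 * (n * 2)) (λ S → χ (does (matching? x₀ w₀ n n 0 S (replicate n true))))
      ≡⟨ Σ-matching x₀ w₀ n 0 (replicate n true) ⟩
    𝒵 (χ ∘ x₀) (χ ∘ w₀) n ∎

  -- Evaluation of the thirty steps

  module _ (s : R) (6s≡1 : (6 ×ₙ 1#) · s ≡ 1#) where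

    ⟦_⟧ : Fraction → R
    ⟦ n , j ⟧ = ι n · s ^ᴿ j

    ⟦⟧-⊛ : ∀ p q → ⟦ p ⊛ q ⟧ ≡ ⟦ p ⟧ · ⟦ q ⟧
    ⟦⟧-⊛ (m , i) (n , j) = trans (cong₂ _·_ (ι-* m n) (^-homo-* s i j))
      (solve 4 (λ m n p q → (m :* n) :* (p :* q) := (m :* p) :* (n :* q)) refl _ _ _ _)

    ⟦⟧-1 : ⟦ 1 , 0 ⟧ ≡ 1#
    ⟦⟧-1 = trans (*-identityʳ _) ι-1

    ι[6^j]·s^j : ∀ j → ⟦ 6 ^ j , j ⟧ ≡ 1#
    ι[6^j]·s^j zero    = ⟦⟧-1
    ι[6^j]·s^j (suc j) = trans (⟦⟧-⊛ (6 , 1) (6 ^ j , j)) (trans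
      (cong₂ _·_ (trans (cong₂ _·_ (ι≡× 6) (*-identityʳ s)) 6s≡1) (ι[6^j]·s^j j)) (*-identityˡ 1#))

    ⟦⟧-1+ : ∀ p → ⟦ 1+ᶠ p ⟧ ≡ 1# ⊕ ⟦ p ⟧
    ⟦⟧-1+ (n , j) = trans (cong (_· s ^ᴿ j) (ι-+ (6 ^ j) n)) (trans
      (solve 3 (λ a b c → (a :+ b) :* c := a :* c :+ b :* c) refl _ _ _)
      (cong (_⊕ ⟦ n , j ⟧) (ι[6^j]·s^j j)))

    expand : ∀ n i j → ⟦ n , i ⟧ ≡ ⟦ n * 6 ^ j , i + j ⟧
    expand n i j = sym (trans (⟦⟧-⊛ (n , i) (6 ^ j , j))
      (trans (cong (⟦ n , i ⟧ ·_) (ι[6^j]·s^j j)) (*-identityʳ _)))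

    ⟦⟧-cong : ∀ p q → T (p ≃ᵇ q) → ⟦ p ⟧ ≡ ⟦ q ⟧
    ⟦⟧-cong (m , i) (n , j) h = trans (expand m i j)
      (trans (cong₂ (λ a b → ⟦ a , b ⟧) (ℕ.≡ᵇ⇒≡ _ _ h) (ℕ.+-comm i j)) (sym (expand n j i)))

    ⟦bit⟧ : ∀ b → ⟦ bitᶠ b ⟧ ≡ χ b
    ⟦bit⟧ true  = ⟦⟧-1
    ⟦bit⟧ false = trans (*-identityʳ _) ι-0

    ⟦ι⟧ : ∀ n → ⟦ n , 0 ⟧ ≡ ι n
    ⟦ι⟧ n = *-identityʳ (ι n)

    𝒵ᶠ : Weights → ℕ → R
    𝒵ᶠ (x , w) = 𝒵 (⟦_⟧ ∘ x) (⟦_⟧ ∘ w)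

    factor : Step → ℕ → R
    factor g k = ⟦ factorᶠ g k ⟧

    total : List Step → ℕ → R
    total []       m = 1#
    total (g ∷ gs) m = product (factor g) 0 (suc (length gs + m) + suc (length gs + m)) · total gs m

    ⟦productᶠ⟧ : ∀ g k n → ⟦ productᶠ g k n ⟧ ≡ product (⟦_⟧ ∘ g) k n
    ⟦productᶠ⟧ g k zero    = ⟦⟧-1
    ⟦productᶠ⟧ g k (suc n) = trans (⟦⟧-⊛ (g k) _) (cong (⟦ g k ⟧ ·_) (⟦productᶠ⟧ g (suc k) n))

    ⟦totalᶠ⟧ : ∀ gs m → ⟦ totalᶠ gs m ⟧ ≡ total gs m
    ⟦totalᶠ⟧ []       m = ⟦⟧-1
    ⟦totalᶠ⟧ (g ∷ gs) m = trans (⟦⟧-⊛ (productᶠ (factorᶠ g) 0 N) (totalᶠ gs m))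
      (cong₂ _·_ (⟦productᶠ⟧ (factorᶠ g) 0 N) (⟦totalᶠ⟧ gs m))
      where N = suc (length gs + m) + suc (length gs + m)

    Valid⇒ : ∀ g x w k → T (Valid g (x , w) k) →
      (factor g k · ⟦ inverseᶠ g k ⟧ ≡ 1#) × (1# ⊕ ⟦ x k ⟧ · ⟦ w k ⟧ ≡ factor g k · factor g (suc k))
    Valid⇒ g x w k h with h₁ , h₂ ← to T-∧ h =
      trans (sym (⟦⟧-⊛ (factorᶠ g k) (inverseᶠ g k))) (trans (⟦⟧-cong (factorᶠ g k ⊛ inverseᶠ g k) (1 , 0) h₁) ⟦⟧-1) ,
      (begin
        1# ⊕ ⟦ x k ⟧ · ⟦ w k ⟧               ≡⟨ cong (1# ⊕_) (⟦⟧-⊛ (x k) (w k)) ⟨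
        1# ⊕ ⟦ x k ⊛ w k ⟧                   ≡⟨ ⟦⟧-1+ (x k ⊛ w k) ⟨
        ⟦ 1+ᶠ (x k ⊛ w k) ⟧                  ≡⟨ ⟦⟧-cong (1+ᶠ (x k ⊛ w k)) (factorᶠ g k ⊛ factorᶠ g (1 + k)) h₂ ⟩
        ⟦ factorᶠ g k ⊛ factorᶠ g (1 + k) ⟧ ≡⟨ ⟦⟧-⊛ (factorᶠ g k) (factorᶠ g (1 + k)) ⟩
        factor g k · factor g (suc k)        ∎)

    Periodicʷ : Weights → Set
    Periodicʷ (x , w) = Periodic x × Periodic w

    every-periodic : ∀ {P : ℕ → Bool} → Periodic P → T (every 10 P) → ∀ k → T (P k)
    every-periodic {P} P-periodic h = periodic 10 (T ∘ P) (every⇒ 10 P h) λ k → subst T (sym (P-periodic k))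

    Valid-periodic : ∀ {g x w} → Periodic x → Periodic w → Periodic (Valid g (x , w))
    Valid-periodic x-p w-p k rewrite x-p k | w-p k = refl

    reduce-periodic : ∀ {g x w} → Periodicʷ (x , w) → Periodicʷ (reduce g (x , w))
    reduce-periodic (x-p , w-p) = (λ k → cong (_⊛ _) (x-p k)) , (λ k → cong (_⊛ _) (w-p (2 + k)))

    run-periodic : ∀ gs {xw} → Periodicʷ xw → Periodicʷ (run gs xw)
    run-periodic []       xw-p = xw-p
    run-periodic (g ∷ gs) xw-p = run-periodic gs (reduce-periodic {g} xw-p)

    reduction-step : ∀ g x w → Periodicʷ (x , w) → T (every 10 (Valid g (x , w))) → ∀ n →
      𝒵ᶠ (x , w) (suc n) ≡ product (factor g) 0 (suc n + suc n) · 𝒵ᶠ (reduce g (x , w)) n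
    reduction-step g x w (x-p , w-p) h n = trans
      (reduction (⟦_⟧ ∘ x) (⟦_⟧ ∘ w) (factor g) (⟦_⟧ ∘ inverseᶠ g)
        (λ k → proj₁ (Valid⇒ g x w k (valid k))) (λ k → proj₂ (Valid⇒ g x w k (valid k))) n)
      (cong (product (factor g) 0 (suc n + suc n) ·_) (𝒵-cong
        (λ k → sym (trans (⟦⟧-⊛ (x k) _) (cong (⟦ x k ⟧ ·_) (⟦⟧-⊛ (factorᶠ g (1 + k)) (inverseᶠ g k)))))
        (λ k → sym (trans (⟦⟧-⊛ (w (2 + k)) _)
          (cong (⟦ w (2 + k) ⟧ ·_) (⟦⟧-⊛ (factorᶠ g (2 + k)) (inverseᶠ g (3 + k)))))) n))
      where
      valid : ∀ k → T (Valid g (x , w) k)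
      valid = every-periodic {Valid g (x , w)} (Valid-periodic {g} {x} {w} x-p w-p) h

    reduction-steps : ∀ gs xw → Periodicʷ xw → T (AllValid gs xw) → ∀ m →
                      𝒵ᶠ xw (length gs + m) ≡ total gs m · 𝒵ᶠ (run gs xw) m
    reduction-steps []       xw      _    _ m = sym (*-identityˡ _)
    reduction-steps (g ∷ gs) (x , w) xw-p h m with h₁ , h₂ ← to T-∧ h = trans
      (reduction-step g x w xw-p h₁ (length gs + m))
      (trans (cong (_ ·_) (reduction-steps gs (reduce g (x , w)) (reduce-periodic {g} xw-p) h₂ m))
        (solve 3 (λ p q r → p :* (q :* r) := (p :* q) :* r) refl _ _ _))

    product-periodic : ∀ (g : ℕ → R) → Periodic g → ∀ k n → product g (10 + k) n ≡ product g k n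
    product-periodic g g-p k zero    = refl
    product-periodic g g-p k (suc n) = cong₂ _·_ (g-p k) (product-periodic g g-p (suc k) n)

    product-+ : ∀ (g : ℕ → R) m k n → product g k (m + n) ≡ product g k m · product g (m + k) n
    product-+ g zero    k n = sym (*-identityˡ _)
    product-+ g (suc m) k n = trans (cong (g k ·_) (trans (product-+ g m (suc k) n)
      (cong (λ l → product g (suc k) m · product g l n) (ℕ.+-suc m k))))
      (solve 3 (λ p q r → p :* (q :* r) := (p :* q) :* r) refl _ _ _)

    total-+5 : ∀ gs → ∀ m → total gs (5 + m) ≡ ⟦ periodᶠ gs ⟧ · total gs m
    total-+5 []       m = sym (trans (*-identityʳ _) ⟦⟧-1)
    total-+5 (g ∷ gs) m = begin
      product (factor g) 0 (suc (length gs + (5 + m)) + suc (length gs + (5 + m))) · total gs (5 + m)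
        ≡⟨ cong₂ _·_ (cong (product (factor g) 0) (double (length gs) m)) (total-+5 gs m) ⟩
      product (factor g) 0 (10 + N) · (⟦ periodᶠ gs ⟧ · total gs m)
        ≡⟨ cong (_· (⟦ periodᶠ gs ⟧ · total gs m)) (trans (product-+ (factor g) 10 0 N)
             (cong₂ _·_ (sym (⟦productᶠ⟧ (factorᶠ g) 0 10))
               (product-periodic (factor g) (λ k → refl) 0 N))) ⟩
      (⟦ π ⟧ · product (factor g) 0 N) · (⟦ periodᶠ gs ⟧ · total gs m)
        ≡⟨ solve 4 (λ p q r t → (p :* q) :* (r :* t) := (p :* r) :* (q :* t)) refl _ _ _ _ ⟩
      (⟦ π ⟧ · ⟦ periodᶠ gs ⟧) · (product (factor g) 0 N · total gs m)
        ≡⟨ cong (_· (product (factor g) 0 N · total gs m)) (⟦⟧-⊛ π (periodᶠ gs)) ⟨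
      ⟦ π ⊛ periodᶠ gs ⟧ · (product (factor g) 0 N · total gs m) ∎
      where
      N = suc (length gs + m) + suc (length gs + m)
      π = productᶠ (factorᶠ g) 0 10
      double : ∀ l m → suc (l + (5 + m)) + suc (l + (5 + m)) ≡ 10 + (suc (l + m) + suc (l + m))
      double = solve-∀

    initial-periodic : Periodicʷ initial
    initial-periodic = (λ k → refl) , (λ k → refl)

    -- Opaque, lest the type checker expands the powers of 3.
    opaque
      power : ℕ → R
      power e = ι (3 ^ e)

      power≡ι : ∀ e → power e ≡ ι (3 ^ e)
      power≡ι e = refl

      power-+ : ∀ d e → power (d + e) ≡ power d · power e
      power-+ d e = trans (cong ι (ℕ.^-distribˡ-+-* 3 d e)) (ι-* (3 ^ d) (3 ^ e))

    ⟦⟧-power : ∀ p e → T (p ≃ᵇ (3 ^ e , 0)) → ⟦ p ⟧ ≡ power e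
    ⟦⟧-power p e h = trans (⟦⟧-cong p (3 ^ e , 0) h) (trans (⟦ι⟧ (3 ^ e)) (sym (power≡ι e)))

    -- The orders 31 to 35 are checked by computation; then both sides gain the factor 3¹⁶ whenever
    -- the order grows by 5.
    total-steps : ∀ m → total steps (suc m) ≡ power (4 * x (31 + m))
    total-steps = periodic 5 _ base advance
      where
      base : ∀ (r : Fin 5) → total steps (suc (toℕ r)) ≡ power (4 * x (31 + toℕ r))
      base r = trans (sym (⟦totalᶠ⟧ steps (suc (toℕ r))))
        (⟦⟧-power (totalᶠ steps (suc (toℕ r))) (4 * x (31 + toℕ r))
          (every⇒ 5 (λ r → totalᶠ steps (suc r) ≃ᵇ (3 ^ (4 * x (31 + r)) , 0)) steps-total r))

      advance : ∀ k → total steps (suc k) ≡ power (4 * x (31 + k)) →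
                total steps (suc (5 + k)) ≡ power (4 * x (31 + (5 + k)))
      advance k h = begin
        total steps (5 + suc k)
          ≡⟨ total-+5 steps (suc k) ⟩
        ⟦ periodᶠ steps ⟧ · total steps (suc k)
          ≡⟨ cong₂ _·_ (⟦⟧-power (periodᶠ steps) 16 steps-period) h ⟩
        power 16 · power (4 * x (31 + k))
          ≡⟨ power-+ 16 (4 * x (31 + k)) ⟨
        power (16 + 4 * x (31 + k))
          ≡⟨ cong power (trans (cong (4 *_) (x-+5 k)) (ℕ.*-distribˡ-+ 4 4 (x (31 + k)))) ⟨
        power (4 * x (36 + k)) ∎

    restored : ∀ n → 𝒵ᶠ (run steps initial) n ≡ 𝒵ᶠ initial n
    restored = 𝒵-cong
      (λ k → ⟦⟧-cong (proj₁ (run steps initial) k) (proj₁ initial k) (proj₁ (same k)))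
      (λ k → ⟦⟧-cong (proj₂ (run steps initial) k) (proj₂ initial k) (proj₂ (same k)))
      where
      run-p : Periodicʷ (run steps initial)
      run-p = run-periodic steps initial-periodic
      same : ∀ k → T (proj₁ (run steps initial) k ≃ᵇ proj₁ initial k) ×
                   T (proj₂ (run steps initial) k ≃ᵇ proj₂ initial k)
      same k = to T-∧ (every-periodic {same-weights}
        (λ k → cong₂ (λ p q → (p ≃ᵇ proj₁ initial k) ∧ (q ≃ᵇ proj₂ initial k)) (proj₁ run-p k) (proj₂ run-p k))
        steps-restore-initial k)

    𝒵ᶠ-initial : ∀ n → ι (M n (B n)) ≡ 𝒵ᶠ initial n
    𝒵ᶠ-initial n = trans (ι-M n) (𝒵-cong (λ k → sym (⟦bit⟧ (x₀ k))) (λ k → sym (⟦bit⟧ (w₀ k))) n)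

    ι-theorem : ∀ m → ι (M (31 + m) (B (31 + m))) ≡
                      ι (3 ^ (4 * x (31 + m)) * M (suc m) (B (suc m)))
    ι-theorem m = begin
      ι (M (31 + m) (B (31 + m)))
        ≡⟨ 𝒵ᶠ-initial (31 + m) ⟩
      𝒵ᶠ initial (30 + suc m)
        ≡⟨ cong (λ l → 𝒵ᶠ initial (l + suc m)) length-steps ⟨
      𝒵ᶠ initial (length steps + suc m)
        ≡⟨ reduction-steps steps initial initial-periodic steps-valid (suc m) ⟩
      total steps (suc m) · 𝒵ᶠ (run steps initial) (suc m)
        ≡⟨ cong₂ _·_ (total-steps m) (trans (restored (suc m)) (sym (𝒵ᶠ-initial (suc m)))) ⟩
      power e · ι (M (suc m) (B (suc m)))
        ≡⟨ cong (_· ι (M (suc m) (B (suc m)))) (power≡ι e) ⟩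
      ι (3 ^ e) · ι (M (suc m) (B (suc m)))
        ≡⟨ ι-* (3 ^ e) (M (suc m) (B (suc m))) ⟨
      ι (3 ^ e * M (suc m) (B (suc m))) ∎
      where e = 4 * x (31 + m)

-- Passage from the rationals to the natural numbers

ℚ-isCommutativeSemiring : IsCommutativeSemiring _≡_ ℚ._+_ ℚ._*_ 0ℚ 1ℚ
ℚ-isCommutativeSemiring = CommutativeRing.isCommutativeSemiring ℚ.+-*-commutativeRing

open WeightedMatchings ℚ-isCommutativeSemiring using (ι; ι≡×; ι-theorem)

-- In ℚ, a sum of at least one copy of 1 is positive, hence not 0.
ι-injective : ∀ m n → ι m ≡ ι n → m ≡ n
ι-injective m n eq = ×1-injective m n (trans (sym (ι≡× m)) (trans eq (ι≡× n)))
  where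
  open CommutativeRing ℚ.+-*-commutativeRing using (ring; semiring)
  open import Algebra.Properties.Ring ring using (+-cancelˡ)
  open import Algebra.Properties.Semiring.Mult semiring using () renaming (_×_ to _×ₙ_)

  nonNegative : ∀ n → ℚ.NonNegative (n ×ₙ 1ℚ)
  nonNegative zero    = _
  nonNegative (suc n) = ℚ.nonNeg+nonNeg⇒nonNeg 1ℚ (n ×ₙ 1ℚ) {{nonNegative n}}

  suc×1≢0 : ∀ n → suc n ×ₙ 1ℚ ≢ 0ℚ
  suc×1≢0 n eq = ℚ.<-irrefl (sym eq)
    (ℚ.positive⁻¹ (suc n ×ₙ 1ℚ) {{ℚ.pos+nonNeg⇒pos 1ℚ (n ×ₙ 1ℚ) {{nonNegative n}}}})

  ×1-injective : ∀ m n → m ×ₙ 1ℚ ≡ n ×ₙ 1ℚ → m ≡ n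
  ×1-injective zero    zero    _  = refl
  ×1-injective zero    (suc n) eq = ⊥-elim (suc×1≢0 n (sym eq))
  ×1-injective (suc m) zero    eq = ⊥-elim (suc×1≢0 m eq)
  ×1-injective (suc m) (suc n) eq = cong suc (×1-injective m n (+-cancelˡ 1ℚ _ _ eq))

theorem8p1 : ∀ (n : ℕ) → n ≥ 31 →
    M n (B n) ≡ 3 ^ (4 * x n) * M (n ∸ 30) (B (n ∸ 30))
theorem8p1 n n≥31 = subst (λ n → M n (B n) ≡ 3 ^ (4 * x n) * M (n ∸ 30) (B (n ∸ 30)))
  (ℕ.m+[n∸m]≡n n≥31)
  -- The inverse of 6 is the rational 1/6, and the equation 6 · 1/6 = 1 holds by computation.
  (ι-injective _ _ (ι-theorem (ℤ.+ 1 ℚ./ 6) refl (n ∸ 31)))
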